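{- Every tree-cograph $G$ is b-monotonic; that is, $\chi_b(H_1) \geq \chi_b(H_2)$ for every induced subgraph $H_1$ of $G$ and every induced subgraph $H_2$ of $H_1$.
   Context: Graphs are finite and simple. For vertex-disjoint graphs $G_1=(V_1,E_1)$ and $G_2=(V_2,E_2)$, the union is $G_1\cup G_2=(V_1\cup V_2,E_1\cup E_2)$, and the join $G_1\vee G_2$ is obtained from the union by adding all edges between $V_1$ and $V_2$. A co-tree is a graph whose complement is a tree. Tree-cographs are defined recursively: a graph $G$ is a tree-cograph if and only if (i) $G$ is a tree or a co-tree, or (ii) $G$ is the union of two tree-cographs, or (iii) $G$ is the join of two tree-cographs. A b-coloring of a graph with $t$ colors is a proper coloring of the vertices with $t$ colors such that every color class contains a vertex that is adjacent to all other $t-1$ color classes. The b-chromatic number $\chi_b(G)$ is the maximum $t$ such that $G$ admits a b-coloring with $t$ colors. -}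

module Defs where

open import Data.Empty using (⊥)
open import Data.Fin.Base using (Fin; zero; suc; inject₁; fromℕ; splitAt; punchOut)
open import Data.Fin.Properties
  using (_≟_; all?; any?; ¬∀⟶∃¬; injective⇒≤; punchOut-injective; suc-injective)
open import Data.Fin.Subset using (Subset; inside; outside; ∣_∣)
open import Data.Nat.Base using (ℕ; zero; suc; _≤_; _<_; _≥_; _+_; s≤s⁻¹)
open import Data.Nat.Properties using (≤∧≢⇒<; n≤0⇒n≡0)
open import Data.Product.Base using (∃; _×_; _,_; proj₁; proj₂)
open import Data.Sum.Base using (_⊎_; inj₁; inj₂)
open import Data.Sum.Relation.Binary.Pointwise
  using (Pointwise; inj₁; inj₂; ⊎-symmetric; ⊎-decidable)
open import Data.Vec.Base using ([]; _∷_)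
import Data.Vec.Functional as VF
open import Function.Base using (id; _∘_; _on_)
open import Function.Bundles using (_↔_; _⇔_; module Inverse)
open import Function.Definitions using (Injective)
open import Level using (0ℓ)
open import Relation.Binary.Construct.Closure.ReflexiveTransitive using (Star)
open import Relation.Binary.Core using (Rel)
open import Relation.Binary.Definitions using (Decidable; Symmetric; Irreflexive)
open import Relation.Binary.PropositionalEquality
  using (_≡_; _≢_; _≗_; refl; sym; trans; cong; subst)
open import Relation.Nullary using (¬_; Dec; yes; no; contradiction)
open import Relation.Nullary.Decidable
  using (map′; ¬?; _×-dec_; _⊎-dec_; _→-dec_)
import Relation.Unary as U

private
  variable
    k m n t : ℕ

record Graph (n : ℕ) : Set₁ where
  field
    Adj    : Rel (Fin n) 0ℓ
    adj?   : Decidable Adj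
    symm   : Symmetric Adj
    irrefl : Irreflexive _≡_ Adj

open Graph public

record _≅_ {m n : ℕ} (G : Graph m) (H : Graph n) : Set where
  field
    vertices : Fin m ↔ Fin n
    edges    : ∀ u v → Adj G u v ⇔ Adj H (Inverse.to vertices u) (Inverse.to vertices v)

complement : Graph n → Graph n
complement G = record
  { Adj    = λ u v → u ≢ v × ¬ Adj G u v
  ; adj?   = λ u v → ¬? (u ≟ v) ×-dec ¬? (adj? G u v)
  ; symm   = λ (u≢v , ¬uv) → u≢v ∘ sym , ¬uv ∘ symm G
  ; irrefl = λ u≡v (u≢v , _) → u≢v u≡v
  }

-- The disjoint vertex set V₁ ∪ V₂ is Fin (m + n), which splitAt m identifies
-- with Fin m ⊎ Fin n.

_∪_ : Graph m → Graph n → Graph (m + n)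
_∪_ {m} G₁ G₂ = record
  { Adj    = Pointwise (Adj G₁) (Adj G₂) on splitAt m
  ; adj?   = λ u v → ⊎-decidable (adj? G₁) (adj? G₂) (splitAt m u) (splitAt m v)
  ; symm   = ⊎-symmetric (symm G₁) (symm G₂)
  ; irrefl = λ { refl → loopless }
  }
  where
  loopless : ∀ {x} → ¬ Pointwise (Adj G₁) (Adj G₂) x x
  loopless (inj₁ e) = irrefl G₁ refl e
  loopless (inj₂ e) = irrefl G₂ refl e

data Across {A B : Set} : Rel (A ⊎ B) 0ℓ where
  left-right : ∀ {a b} → Across (inj₁ a) (inj₂ b)
  right-left : ∀ {a b} → Across (inj₂ b) (inj₁ a)

across? : {A B : Set} → Decidable (Across {A} {B})
across? (inj₁ _) (inj₁ _) = no λ ()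
across? (inj₁ _) (inj₂ _) = yes left-right
across? (inj₂ _) (inj₁ _) = yes right-left
across? (inj₂ _) (inj₂ _) = no λ ()

_∨_ : Graph m → Graph n → Graph (m + n)
_∨_ {m} G₁ G₂ = record
  { Adj    = λ u v → Adj (G₁ ∪ G₂) u v ⊎ Across (splitAt m u) (splitAt m v)
  ; adj?   = λ u v → adj? (G₁ ∪ G₂) u v ⊎-dec across? (splitAt m u) (splitAt m v)
  ; symm   = λ { (inj₁ e) → inj₁ (symm (G₁ ∪ G₂) e) ; (inj₂ e) → inj₂ (flip e) }
  ; irrefl = λ { u≡v (inj₁ e) → irrefl (G₁ ∪ G₂) u≡v e ; refl (inj₂ e) → loopless e }
  }
  where
  flip : {A B : Set} → Symmetric (Across {A} {B})
  flip left-right = right-left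
  flip right-left = left-right
  loopless : {A B : Set} {x : A ⊎ B} → ¬ Across x x
  loopless ()

-- The elements of S in increasing order.

element : (S : Subset n) → Fin ∣ S ∣ → Fin n
element (inside  ∷ S) zero    = zero
element (inside  ∷ S) (suc i) = suc (element S i)
element (outside ∷ S) i       = suc (element S i)

element-injective : (S : Subset n) → Injective _≡_ _≡_ (element S)
element-injective (inside  ∷ S) {zero}  {zero}  _  = refl
element-injective (inside  ∷ S) {suc i} {suc j} eq =
  cong suc (element-injective S (suc-injective eq))
element-injective (outside ∷ S) eq =
  element-injective S (suc-injective eq)

-- The subgraph induced by S, its vertices renumbered along element S.

_[_] : Graph n → (S : Subset n) → Graph ∣ S ∣
G [ S ] = record
  { Adj    = Adj G on element S
  ; adj?   = λ u v → adj? G (element S u) (element S v)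
  ; symm   = symm G
  ; irrefl = λ u≡v → irrefl G (cong (element S) u≡v)
  }

Connected : Graph n → Set
Connected G = ∀ u v → Star (Adj G) u v

-- A cycle v₀ v₁ … vₗ v₀ through l + 1 ≥ 3 distinct vertices.

record Cycle (G : Graph n) : Set where
  field
    {last}   : ℕ
    long     : 2 ≤ last
    vertex   : Fin (suc last) → Fin n
    distinct : Injective _≡_ _≡_ vertex
    step     : ∀ i → Adj G (vertex (inject₁ i)) (vertex (suc i))
    close    : Adj G (vertex (fromℕ last)) (vertex zero)

record IsTree {n : ℕ} (G : Graph n) : Set where
  field
    nonempty  : 0 < n
    connected : Connected G
    acyclic   : ¬ Cycle G

IsCotree : Graph n → Set
IsCotree G = IsTree (complement G)

-- The operands of a union or join have vertex sets Fin m and Fin k, so a graph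
-- is compared with their union or join up to renaming of vertices.

data TreeCograph {n : ℕ} (G : Graph n) : Set₁ where
  tree   : IsTree G → TreeCograph G
  cotree : IsCotree G → TreeCograph G
  union  : {G₁ : Graph m} {G₂ : Graph k} →
           TreeCograph G₁ → TreeCograph G₂ → G ≅ (G₁ ∪ G₂) → TreeCograph G
  join   : {G₁ : Graph m} {G₂ : Graph k} →
           TreeCograph G₁ → TreeCograph G₂ → G ≅ (G₁ ∨ G₂) → TreeCograph G

Proper : Graph n → (Fin n → Fin t) → Set
Proper G c = ∀ u v → Adj G u v → c u ≢ c v

Dominating : Graph n → (Fin n → Fin t) → Fin n → Set
Dominating G c v = ∀ j → j ≢ c v → ∃ λ w → Adj G v w × c w ≡ j

IsBColoring : Graph n → (Fin n → Fin t) → Set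
IsBColoring G c = Proper G c × (∀ i → ∃ λ v → c v ≡ i × Dominating G c v)

HasBColoring : Graph n → ℕ → Set
HasBColoring {n} G t = ∃ λ (c : Fin n → Fin t) → IsBColoring G c

IsMaximum : (ℕ → Set) → ℕ → Set
IsMaximum P m = P m × (∀ t → P t → t ≤ m)

-- The maximum defining the b-chromatic number exists: having a b-coloring
-- with t colors is decidable, forces t ≤ n, and holds for some t.

private
  search : ∀ n {P : (Fin n → Fin t) → Set} →
           (∀ {f g} → f ≗ g → P f → P g) → U.Decidable P → Dec (∃ P)
  search zero    resp P? = map′ (λ p → _ , p) (λ (_ , p) → resp (λ ()) p) (P? λ ())
  search (suc n) resp P? = map′
    (λ (x , f , p) → x VF.∷ f , p)
    (λ (f , p) → f zero , f ∘ suc , resp (λ { zero → refl ; (suc _) → refl }) p)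
    (any? λ x → search n
      (λ f≗g → resp λ { zero → refl ; (suc i) → f≗g i })
      (λ f → P? (x VF.∷ f)))

  dominating? : (G : Graph n) (c : Fin n → Fin t) → U.Decidable (Dominating G c)
  dominating? G c v =
    all? λ j → ¬? (j ≟ c v) →-dec any? λ w → adj? G v w ×-dec (c w ≟ j)

  represented? : (G : Graph n) (c : Fin n → Fin t) →
                 U.Decidable (λ i → ∃ λ v → c v ≡ i × Dominating G c v)
  represented? G c i = any? λ v → (c v ≟ i) ×-dec dominating? G c v

  isBColoring? : (G : Graph n) → U.Decidable (IsBColoring {t = t} G)
  isBColoring? G c =
    (all? λ u → all? λ v → adj? G u v →-dec ¬? (c u ≟ c v))
      ×-dec all? (represented? G c)

  isBColoring-resp : (G : Graph n) {c d : Fin n → Fin t} → c ≗ d →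
                     IsBColoring G c → IsBColoring G d
  isBColoring-resp G c≗d (proper , rep) =
      (λ u v e eq → proper u v e (trans (c≗d u) (trans eq (sym (c≗d v)))))
    , λ i → let (v , cv≡i , dom) = rep i in
        v , trans (sym (c≗d v)) cv≡i
          , λ j j≢ → let (w , e , cw≡j) = dom j (λ eq → j≢ (trans eq (c≗d v))) in
              w , e , trans (sym (c≗d w)) cw≡j

  hasBColoring? : (G : Graph n) → U.Decidable (HasBColoring G)
  hasBColoring? {n} G t = search n (isBColoring-resp G) (isBColoring? G)

  hasBColoring⇒≤ : (G : Graph n) → ∀ t → HasBColoring G t → t ≤ n
  hasBColoring⇒≤ G t (c , _ , rep) = injective⇒≤ {f = λ i → proj₁ (rep i)} λ {i} {j} eq →
    trans (sym (proj₁ (proj₂ (rep i)))) (trans (cong c eq) (proj₁ (proj₂ (rep j))))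

  -- If color i has no dominating vertex, every vertex of color i can be moved
  -- to a color absent from its neighbourhood, which eliminates i.
  eliminate : (G : Graph n) (c : Fin n → Fin (suc t)) → Proper G c → ∀ i →
              ¬ (∃ λ v → c v ≡ i × Dominating G c v) →
              ∃ λ (d : Fin n → Fin t) → Proper G d
  eliminate {n} {t} G c proper i unrep = d , d-proper
    where
    Free : Fin n → Fin (suc t) → Set
    Free v j = i ≢ j × (c v ≢ i → c v ≡ j) ×
               (c v ≡ i → ∀ w → Adj G v w → c w ≢ j)

    free : ∀ v → ∃ (Free v)
    free v with c v ≟ i
    ... | no  cv≢i = c v , cv≢i ∘ sym , (λ _ → refl) , λ cv≡i → contradiction cv≡i cv≢i
    ... | yes cv≡i
      with ¬∀⟶∃¬ (suc t) (λ j → j ≢ c v → ∃ λ w → Adj G v w × c w ≡ j)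
             (λ j → ¬? (j ≟ c v) →-dec any? λ w → adj? G v w ×-dec (c w ≟ j))
             (λ dom → unrep (v , cv≡i , dom))
    ... | j , ¬p = j
        , (λ i≡j → ¬p λ j≢cv → contradiction (trans (sym i≡j) (sym cv≡i)) j≢cv)
        , (λ cv≢i → contradiction cv≡i cv≢i)
        , λ _ w e cw≡j → ¬p λ _ → w , e , cw≡j

    new : Fin n → Fin (suc t)
    new v = proj₁ (free v)

    i≢new : ∀ v → i ≢ new v
    i≢new v = proj₁ (proj₂ (free v))

    kept : ∀ v → c v ≢ i → c v ≡ new v
    kept v = proj₁ (proj₂ (proj₂ (free v)))

    moved : ∀ v → c v ≡ i → ∀ w → Adj G v w → c w ≢ new v
    moved v = proj₂ (proj₂ (proj₂ (free v)))

    new-proper : Proper G new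
    new-proper u v e eq = cases (c u ≟ i) (c v ≟ i)
      where
      cases : Dec (c u ≡ i) → Dec (c v ≡ i) → ⊥
      cases (yes p) (yes q) = proper u v e (trans p (sym q))
      cases (yes p) (no  q) = moved u p v e (trans (kept v q) (sym eq))
      cases (no  p) (yes q) = moved v q u (symm G e) (trans (kept u p) eq)
      cases (no  p) (no  q) = proper u v e (trans (kept u p) (trans eq (sym (kept v q))))

    d : Fin n → Fin t
    d v = punchOut (i≢new v)

    d-proper : Proper G d
    d-proper u v e eq = new-proper u v e (punchOut-injective (i≢new u) (i≢new v) eq)

  improve : (G : Graph n) → ∀ t (c : Fin n → Fin t) → Proper G c → ∃ (HasBColoring G)
  improve G zero    c proper = zero , c , proper , λ ()
  improve G (suc t) c proper with all? (represented? G c)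
  ... | yes rep  = suc t , c , proper , rep
  ... | no  ¬rep =
    let (i , unrep)  = ¬∀⟶∃¬ (suc t) _ (represented? G c) ¬rep
        (d , proper) = eliminate G c proper i unrep
    in improve G t d proper

  hasSomeBColoring : (G : Graph n) → ∃ (HasBColoring G)
  hasSomeBColoring {n} G = improve G n id λ u v e u≡v → irrefl G u≡v e

  maximum : {P : ℕ → Set} → U.Decidable P → ∀ b → (∀ t → P t → t ≤ b) →
            ∃ P → ∃ (IsMaximum P)
  maximum {P} P? b bound (t , p) with P? b
  ... | yes pb = b , pb , bound
  maximum {P} P? zero    bound (t , p) | no ¬pb =
    contradiction (subst P (n≤0⇒n≡0 (bound t p)) p) ¬pb
  maximum {P} P? (suc b) bound (t , p) | no ¬pb = maximum P? b
    (λ s q → s≤s⁻¹ (≤∧≢⇒< (bound s q) λ { refl → ¬pb q })) (t , p)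

bChromatic : (G : Graph n) → ∃ (IsMaximum (HasBColoring G))
bChromatic {n} G = maximum (hasBColoring? G) n (hasBColoring⇒≤ G) (hasSomeBColoring G)

χb : Graph n → ℕ
χb G = proj₁ (bChromatic G)

χb-isMaximum : (G : Graph n) → IsMaximum (HasBColoring G) (χb G)
χb-isMaximum G = proj₂ (bChromatic G)

BMonotonic : Graph n → Set
BMonotonic {n} G = (S₁ : Subset n) (S₂ : Subset ∣ S₁ ∣) →
  χb (G [ S₁ ]) ≥ χb ((G [ S₁ ]) [ S₂ ])

{-# OPTIONS --safe #-}

-- Call a graph monotone if, for vertex sets S ⊆ S′ and a set K of colours that
-- suffices for S′, every colouring of S by K can be traded for a colouring of
-- S′ by K in which at least the same colours are dominated.  With K the colours
-- of an optimal b-coloring of S, all of K becomes dominated on S′.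
--
-- Unions: treat the two sides separately.  Joins: the sides use disjoint colour
-- sets A and B; if the first side of S′ cannot be coloured by A, a least set
-- A⁺ ⊇ A that suffices is completely dominated, and the second side keeps only
-- the vertices whose colour is not in A⁺.
--
-- Trees: to add a vertex v, exchange two colours within suitable components of
-- the forest minus v, so that v gets a colour absent from its neighbourhood; if
-- that would lose the dominated colour of v itself, then v becomes dominating.
--
-- Co-trees: colour classes form a matching of the forest F, and x is dominating
-- iff no F-neighbour of x is unmatched.  A new vertex first gets a colour of its
-- own; one colour is then saved along an augmenting path of length one or three.
-- If there is no such path, all colours are dominated, and a colour is saved by
-- induction along leaves of F.

module Submission where

open import Data.Empty using (⊥-elim)
open import Data.Fin.Base using (Fin; zero; suc; inject₁; fromℕ; fromℕ<; inject≤; opposite; splitAt; _↑ˡ_; _↑ʳ_)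
open import Data.Fin.Permutation.Components using (transpose; transpose-inverse)
open import Data.Fin.Properties
  using (_≟_; all?; any?; suc-injective; opposite-involutive; inject≤-injective; splitAt-↑ˡ; splitAt-↑ʳ; join-splitAt)
import Data.Fin.Subset as Sub
import Data.Fin.Subset.Properties as SubP
open import Data.List.Base using (List; []; _∷_; allFin)
import Data.List.Membership.DecPropositional as DecMembership
open import Data.List.Membership.Propositional using () renaming (_∈_ to _∈ˡ_)
open import Data.List.Membership.Propositional.Properties using (∈-allFin)
open import Data.List.Relation.Unary.Any using (here; there)
open import Data.Nat.Base using (ℕ; zero; suc; _+_; _≤_; _<_; z≤n; s≤s; s≤s⁻¹)
open import Data.Nat.Properties using (≤-trans; n≮0; ≮⇒≥; <⇒≤; <⇒≱)
open import Data.Product.Base using (∃; _×_; _,_; proj₁; proj₂)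
open import Data.Sum.Base using (_⊎_; inj₁; inj₂; [_,_]′; swap)
import Data.Sum.Relation.Binary.Pointwise as PW
open import Data.Unit.Base using (⊤; tt)
import Data.Vec.Functional as VF
open import Data.Vec.Functional.Properties using (updateAt-updates; updateAt-minimal)
open import Function.Base using (_∘_; const; id; case_of_)
open import Function.Bundles using (_⇔_; mk⇔; module Inverse; module Equivalence)
open import Function.Definitions using (Injective)
open import Relation.Binary.Construct.Closure.ReflexiveTransitive using (Star; ε; _◅_)
open import Relation.Binary.PropositionalEquality
  using (_≡_; _≢_; refl; sym; trans; cong; cong₂; subst; subst₂; ≢-sym)
open import Relation.Nullary using (¬_; Dec; yes; no; contradiction)
open import Relation.Nullary.Decidable
  using (¬?; _×-dec_; _⊎-dec_; _→-dec_; dec-true; dec-false; map′; decidable-stable)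

open import Defs

-- Decidable sets, transpositions and updates of functions.

record DecSet (A : Set) : Set₁ where
  field
    El  : A → Set
    el? : ∀ x → Dec (El x)

open DecSet

infix 4 _∈_ _∈?_ _⊆_
infixl 6 _⊕_ _⊖_

_∈_ : {A : Set} → A → DecSet A → Set
x ∈ S = El S x

_∈?_ : {A : Set} (x : A) (S : DecSet A) → Dec (x ∈ S)
x ∈? S = el? S x

_⊆_ : {A : Set} → DecSet A → DecSet A → Set
S ⊆ T = ∀ {x} → x ∈ S → x ∈ T

full : {A : Set} → DecSet A
full = record { El = λ _ → ⊤ ; el? = λ _ → yes tt }

_⊕_ : {n : ℕ} → DecSet (Fin n) → Fin n → DecSet (Fin n)
S ⊕ v = record { El = λ x → x ∈ S ⊎ x ≡ v ; el? = λ x → x ∈? S ⊎-dec x ≟ v }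

_⊖_ : {n : ℕ} → DecSet (Fin n) → Fin n → DecSet (Fin n)
S ⊖ v = record { El = λ x → x ∈ S × x ≢ v ; el? = λ x → x ∈? S ×-dec ¬? (x ≟ v) }

preimage : {A B : Set} → (A → B) → DecSet B → DecSet A
preimage f S = record { El = El S ∘ f ; el? = el? S ∘ f }

_∩_ : {A : Set} → DecSet A → DecSet A → DecSet A
S ∩ T = record { El = λ x → x ∈ S × x ∈ T ; el? = λ x → x ∈? S ×-dec x ∈? T }

_∖_ : {A : Set} → DecSet A → DecSet A → DecSet A
S ∖ T = record { El = λ x → x ∈ S × ¬ x ∈ T ; el? = λ x → x ∈? S ×-dec ¬? (x ∈? T) }

module _ {A : Set} (S T : DecSet A) where

  -- Bookkeeping for recursions along `allFin`: the list holds the elements of `T` that may still be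
  -- missing from `S`.
  uncons-cover : ∀ {x xs} → (∀ {v} → v ∈ T → v ∈ S ⊎ v ∈ˡ x ∷ xs) → (x ∈ T → x ∈ S) →
                 ∀ {v} → v ∈ T → v ∈ S ⊎ v ∈ˡ xs
  uncons-cover cover x∈ v∈ with cover v∈
  ... | inj₁ v∈S          = inj₁ v∈S
  ... | inj₂ (here refl)  = inj₁ (x∈ v∈)
  ... | inj₂ (there v∈xs) = inj₂ v∈xs

  []-cover : (∀ {v} → v ∈ T → v ∈ S ⊎ v ∈ˡ []) → T ⊆ S
  []-cover cover v∈ with cover v∈
  ... | inj₁ v∈S = v∈S

module _ {n : ℕ} where

  transpose-left : (i j : Fin n) → transpose i j i ≡ j
  transpose-left i j rewrite dec-true (i ≟ i) refl = refl

  transpose-right : (i j : Fin n) → transpose i j j ≡ i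
  transpose-right i j with j ≟ i
  ... | yes j≡i = j≡i
  ... | no  _ rewrite dec-true (j ≟ j) refl = refl

  transpose-other : {i j k : Fin n} → k ≢ i → k ≢ j → transpose i j k ≡ k
  transpose-other {i} {j} {k} k≢i k≢j
    rewrite dec-false (k ≟ i) k≢i | dec-false (k ≟ j) k≢j = refl

  transpose-injective : (i j : Fin n) {k l : Fin n} → transpose i j k ≡ transpose i j l → k ≡ l
  transpose-injective i j eq =
    trans (sym (transpose-inverse j i)) (trans (cong (transpose j i) eq) (transpose-inverse j i))

  transpose-closed : (K : DecSet (Fin n)) {i j k : Fin n} →
                     i ∈ K → j ∈ K → k ∈ K → transpose i j k ∈ K
  transpose-closed K {i} {j} {k} i∈ j∈ k∈ with k ≟ i
  ... | yes _ = j∈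
  ... | no  _ with k ≟ j
  ... | yes _ = i∈
  ... | no  _ = k∈

  -- It does not matter which colour is saved: swapping `i` and `k` carries a palette without `i` to
  -- one without `k`.
  transpose-⊖ : (K : DecSet (Fin n)) {i k : Fin n} → i ∈ K → k ∈ K →
                ∀ {j} → j ∈ K ⊖ i → transpose i k j ∈ K ⊖ k
  transpose-⊖ K {i} {k} i∈ k∈ (j∈ , j≢) = transpose-closed K i∈ k∈ j∈ , λ eq →
    j≢ (transpose-injective i k (trans eq (sym (transpose-left i k))))

infixl 10 _[_≔_]

_[_≔_] : {n : ℕ} {A : Set} → (Fin n → A) → Fin n → A → Fin n → A
c [ v ≔ i ] = VF.updateAt c v (const i)

module _ {n : ℕ} {A : Set} (c : Fin n → A) {v : Fin n} {i : A} where

  ≔-same : (c [ v ≔ i ]) v ≡ i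
  ≔-same = updateAt-updates v c

  ≔-other : {w : Fin n} → w ≢ v → (c [ v ≔ i ]) w ≡ c w
  ≔-other {w} = updateAt-minimal w v c

-- Partial colourings and dominated colours.

module _ {n t : ℕ} (G : Graph n) (S : DecSet (Fin n)) where

  -- Colourings are total functions constrained on `S` only, and palettes are subsets of a fixed
  -- `Fin t`; passing to fewer vertices or colours renumbers nothing.
  record IsColouring (K : DecSet (Fin t)) (c : Fin n → Fin t) : Set where
    field
      within : ∀ {v} → v ∈ S → c v ∈ K
      proper : ∀ {u v} → u ∈ S → v ∈ S → Adj G u v → c u ≢ c v

  Colourable : DecSet (Fin t) → Set
  Colourable K = ∃ (IsColouring K)

  Sees : (Fin n → Fin t) → Fin n → Fin t → Set
  Sees c v j = ∃ λ w → w ∈ S × Adj G v w × c w ≡ j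

  sees? : ∀ c v j → Dec (Sees c v j)
  sees? c v j = any? λ w → w ∈? S ×-dec adj? G v w ×-dec c w ≟ j

  DominatingIn : DecSet (Fin t) → (Fin n → Fin t) → Fin n → Set
  DominatingIn K c v = ∀ {j} → j ∈ K → j ≢ c v → Sees c v j

  dominatingIn? : ∀ K c v → Dec (DominatingIn K c v)
  dominatingIn? K c v = map′ (λ f {j} → f j) (λ f j → f {j})
    (all? λ j → j ∈? K →-dec ¬? (j ≟ c v) →-dec sees? c v j)

  Dominated : DecSet (Fin t) → (Fin n → Fin t) → Fin t → Set
  Dominated K c j = ∃ λ v → v ∈ S × c v ≡ j × DominatingIn K c v

  dominated? : ∀ K c j → Dec (Dominated K c j)
  dominated? K c j = any? λ v → v ∈? S ×-dec c v ≟ j ×-dec dominatingIn? K c v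

  Used : (Fin n → Fin t) → Fin t → Set
  Used c j = ∃ λ v → v ∈ S × c v ≡ j

  used? : ∀ c j → Dec (Used c j)
  used? c j = any? λ v → v ∈? S ×-dec c v ≟ j

  Onto : DecSet (Fin t) → (Fin n → Fin t) → Set
  Onto K c = ∀ {j} → j ∈ K → Used c j

  -- A dominating vertex has its own colour and sees all the others. It follows that a colouring
  -- which misses a colour of `K` dominates nothing and may be traded for any other.
  dominated⇒onto : ∀ {K c j} → Dominated K c j → Onto K c
  dominated⇒onto {c = c} (v , v∈ , _ , dom) {k} k∈ with k ≟ c v
  ... | yes k≡ = v , v∈ , sym k≡
  ... | no  k≢ = let (w , w∈ , _ , eq) = dom k∈ k≢ in w , w∈ , eq

  unused⊎onto : ∀ K c → (∃ λ j → j ∈ K × ¬ Used c j) ⊎ Onto K c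
  unused⊎onto K c with any? (λ j → j ∈? K ×-dec ¬? (used? c j))
  ... | yes p = inj₁ p
  ... | no ¬p = inj₂ λ {j} j∈ → decidable-stable (used? c j) λ ¬u → ¬p (j , j∈ , ¬u)

open IsColouring

module _ {n : ℕ} (G : Graph n) where

  Extends : {t : ℕ} (K : DecSet (Fin t)) (S S′ : DecSet (Fin n)) (c : Fin n → Fin t) → Set
  Extends K S S′ c = ∃ λ c′ →
    IsColouring G S′ K c′ × (∀ {j} → Dominated G S K c j → Dominated G S′ K c′ j)

  Monotone : Set₁
  Monotone = ∀ {t} (K : DecSet (Fin t)) S S′ → S ⊆ S′ → Colourable G S′ K →
    ∀ c → IsColouring G S K c → Extends K S S′ c

  VertexStep : Set₁
  VertexStep = ∀ {t} (K : DecSet (Fin t)) S v → ¬ v ∈ S → Colourable G (S ⊕ v) K →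
    ∀ c → IsColouring G S K c → Extends K S (S ⊕ v) c

  IsColouring-⊆ : {t : ℕ} {K L : DecSet (Fin t)} {S T : DecSet (Fin n)} {c : Fin n → Fin t} →
    S ⊆ T → K ⊆ L → IsColouring G T K c → IsColouring G S L c
  IsColouring-⊆ S⊆T K⊆L col = record
    { within = λ v∈ → K⊆L (within col (S⊆T v∈))
    ; proper = λ u∈ v∈ → proper col (S⊆T u∈) (S⊆T v∈) }

  Sees-⊆ : {t : ℕ} {S T : DecSet (Fin n)} {c : Fin n → Fin t} {v : Fin n} {j : Fin t} →
    S ⊆ T → Sees G S c v j → Sees G T c v j
  Sees-⊆ S⊆T (w , w∈ , e , eq) = w , S⊆T w∈ , e , eq

  Dominated-⊆ : {t : ℕ} {K : DecSet (Fin t)} {S T : DecSet (Fin n)} {c : Fin n → Fin t} {j : Fin t} →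
    S ⊆ T → Dominated G S K c j → Dominated G T K c j
  Dominated-⊆ {S = S} {T} S⊆T (v , v∈ , eq , dom) =
    v , S⊆T v∈ , eq , λ j∈ j≢ → Sees-⊆ {S = S} {T} S⊆T (dom j∈ j≢)

  relabel : {t : ℕ} {K L : DecSet (Fin t)} {S : DecSet (Fin n)} {c : Fin n → Fin t}
    (σ : Fin t → Fin t) → (∀ {i j} → σ i ≡ σ j → i ≡ j) → (∀ {i} → i ∈ K → σ i ∈ L) →
    IsColouring G S K c → IsColouring G S L (σ ∘ c)
  relabel σ inj σ∈ col = record
    { within = λ v∈ → σ∈ (within col v∈)
    ; proper = λ u∈ v∈ e eq → proper col u∈ v∈ e (inj eq) }

  -- The vertices of `S′` are added one at a time; every intermediate set is colourable by `K`
  -- because `S′` is.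
  vertexStep⇒monotone : VertexStep → Monotone
  vertexStep⇒monotone step K S S′ S⊆S′ (c₀ , col₀) c col =
    go (allFin n) S S⊆S′ (λ {v} _ → inj₂ (∈-allFin v)) c col
    where
    go : ∀ xs S → S ⊆ S′ → (∀ {v} → v ∈ S′ → v ∈ S ⊎ v ∈ˡ xs) →
         ∀ c → IsColouring G S K c → Extends K S S′ c
    go [] S S⊆ cover c col =
      c , IsColouring-⊆ {K = K} {K} {S′} {S} ([]-cover S S′ cover) id col ,
      λ {j} → Dominated-⊆ {K = K} {S} {S′} S⊆
    go (x ∷ xs) S S⊆ cover c col with x ∈? S | x ∈? S′
    ... | yes x∈S | _        = go xs S S⊆ (uncons-cover S S′ cover λ _ → x∈S) c col
    ... | no  _   | no x∉S′  = go xs S S⊆ (uncons-cover S S′ cover λ x∈ → contradiction x∈ x∉S′) c col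
    ... | no x∉S  | yes x∈S′ =
      let (c₁ , col₁ , dom₁) = step K S x x∉S (c₀ , IsColouring-⊆ {K = K} {K} {S ⊕ x} {S′} sub id col₀) c col
          (c₂ , col₂ , dom₂) = go xs (S ⊕ x) sub (uncons-cover (S ⊕ x) S′ cover⁺ λ _ → inj₂ refl) c₁ col₁
      in c₂ , col₂ , λ d → dom₂ (dom₁ d)
      where
      sub : S ⊕ x ⊆ S′
      sub (inj₁ v∈S) = S⊆ v∈S
      sub (inj₂ refl) = x∈S′
      cover⁺ : ∀ {v} → v ∈ S′ → v ∈ S ⊕ x ⊎ v ∈ˡ x ∷ xs
      cover⁺ v∈ with cover v∈
      ... | inj₁ v∈S = inj₁ (inj₁ v∈S)
      ... | inj₂ v∈xs = inj₂ v∈xs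

-- Trees

-- Labels are constant on the components of `G − v` and separate the neighbours of `v`. Distinct
-- components may share a label, as long as at most one of them contains a neighbour of `v`.
record Components {n : ℕ} (G : Graph n) (v : Fin n) : Set where
  field
    component      : Fin n → Fin n
    edge⇒same      : ∀ {u w} → u ≢ v → w ≢ v → Adj G u w → component u ≡ component w
    neighbour-uniq : ∀ {u w} → Adj G v u → Adj G v w → component u ≡ component w → u ≡ w

open Components

transpose-refl : {n : ℕ} (i j : Fin n) → transpose i i j ≡ j
transpose-refl i j = case j ≟ i of λ where
  (yes refl) → transpose-left i i
  (no  j≢i)  → transpose-other j≢i j≢i

module ForestStep {n t : ℕ} (G : Graph n) (S : DecSet (Fin n)) (v : Fin n) (v∉S : ¬ v ∈ S)
  (K : DecSet (Fin t)) (c : Fin n → Fin t) (col : IsColouring G S K c)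
  (C : Components G v) where

  comp : Fin n → Fin n
  comp = component C

  ≢v : ∀ {w} → w ∈ S → w ≢ v
  ≢v w∈ refl = v∉S w∈

  DomIn : Fin n → Fin t → Set
  DomIn l j = ∃ λ x → x ∈ S × comp x ≡ l × c x ≡ j × DominatingIn G S K c x

  domIn? : ∀ l j → Dec (DomIn l j)
  domIn? l j = any? λ x → x ∈? S ×-dec comp x ≟ l ×-dec c x ≟ j ×-dec dominatingIn? G S K c x

  -- Colour v by i and exchange the colours i and q l in every component l of G − v.
  module Recolour {i : Fin t} (i∈ : i ∈ K) (q : Fin n → Fin t) (q∈ : ∀ l → q l ∈ K)
    (q-free : ∀ {u} → u ∈ S → Adj G v u → c u ≢ q (comp u)) where

    π : Fin n → Fin t → Fin t
    π l = transpose i (q l)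

    c′ : Fin n → Fin t
    c′ = (λ w → π (comp w) (c w)) [ v ≔ i ]

    c′-v : c′ v ≡ i
    c′-v = ≔-same (λ w → π (comp w) (c w))

    c′-S : ∀ {w} → w ∈ S → c′ w ≡ π (comp w) (c w)
    c′-S w∈ = ≔-other (λ w → π (comp w) (c w)) (≢v w∈)

    v≠ : ∀ {w} → w ∈ S → Adj G v w → c′ v ≢ c′ w
    v≠ {w} w∈ e eq = q-free w∈ e (sym (transpose-injective i (q (comp w))
      (trans (transpose-right i (q (comp w))) (trans (sym c′-v) (trans eq (c′-S w∈))))))

    col′ : IsColouring G (S ⊕ v) K c′
    within col′ (inj₁ w∈) = subst (_∈ K) (sym (c′-S w∈))
      (transpose-closed K i∈ (q∈ _) (within col w∈))
    within col′ (inj₂ refl) = subst (_∈ K) (sym c′-v) i∈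
    proper col′ {a} {b} (inj₁ a∈) (inj₁ b∈) e eq = proper col a∈ b∈ e
      (transpose-injective i (q (comp b)) (trans
        (cong (λ l → π l (c a)) (sym (edge⇒same C (≢v a∈) (≢v b∈) e)))
        (trans (sym (c′-S a∈)) (trans eq (c′-S b∈)))))
    proper col′ (inj₁ a∈) (inj₂ refl) e eq = v≠ a∈ (symm G e) (sym eq)
    proper col′ (inj₂ refl) (inj₁ b∈) e eq = v≠ b∈ e eq
    proper col′ (inj₂ refl) (inj₂ refl) e eq = irrefl G refl e

    -- One permutation acts on all of a component, so a dominating vertex stays dominating and its
    -- colour moves along.
    carried : ∀ {l j} → DomIn l j → Dominated G (S ⊕ v) K c′ (π l j)
    carried (x , x∈ , refl , refl , dom) = x , inj₁ x∈ , c′-S x∈ , λ {k} k∈ k≢ →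
      let k₀           = transpose (q (comp x)) i k
          (w , w∈ , e , eq) = dom (transpose-closed K (q∈ _) i∈ k∈) λ k₀≡ → k≢
            (trans (sym (transpose-inverse i (q (comp x)) {k}))
              (trans (cong (π (comp x)) k₀≡) (sym (c′-S x∈))))
      in w , inj₁ w∈ , e , trans (c′-S w∈)
           (trans (cong₂ π (sym (edge⇒same C (≢v x∈) (≢v w∈) e)) eq) (transpose-inverse i _))

  Neighbour : Fin n → Fin t → Set
  Neighbour u i = u ∈ S × Adj G v u × c u ≡ i

  neighbour? : ∀ u i → Dec (Neighbour u i)
  neighbour? u i = u ∈? S ×-dec adj? G v u ×-dec c u ≟ i

  -- Only components in which `v` has a neighbour coloured `i` need an exchange, and that neighbour
  -- is unique, so `κ` determines the other colour. Elsewhere `q` is `i` and nothing moves.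
  module Escape {i : Fin t} (i∈ : i ∈ K) (κ : ∀ {u} → Neighbour u i → Fin t)
    (κ∈ : ∀ {u} (a : Neighbour u i) → κ a ∈ K) (κ≢ : ∀ {u} (a : Neighbour u i) → κ a ≢ i) where

    find : ∀ l → Dec (∃ λ u → Neighbour u i × comp u ≡ l)
    find l = any? λ u → neighbour? u i ×-dec comp u ≟ l

    choose : ∀ {l} → Dec (∃ λ u → Neighbour u i × comp u ≡ l) → Fin t
    choose (yes (_ , a , _)) = κ a
    choose (no  _)           = i

    q : Fin n → Fin t
    q l = choose (find l)

    q∈ : ∀ l → q l ∈ K
    q∈ l with find l
    ... | yes (_ , a , _) = κ∈ a
    ... | no  _           = i∈

    q-spec : ∀ l → q l ≡ i ⊎ ∃ λ u → ∃ λ (a : Neighbour u i) → comp u ≡ l × q l ≡ κ a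
    q-spec l with find l
    ... | yes (u , a , eq) = inj₂ (u , a , eq , refl)
    ... | no  _            = inj₁ refl

    -- The component of `u` contains no second neighbour of `v`, hence none coloured `i`.
    untouched : ∀ {u} → Adj G v u → c u ≢ i → q (comp u) ≡ i
    untouched {u} e c≢ with find (comp u)
    ... | no  _ = refl
    ... | yes (u′ , (_ , e′ , refl) , eq) = contradiction (cong c (sym (neighbour-uniq C e′ e eq))) c≢

    q-free : ∀ {u} → u ∈ S → Adj G v u → c u ≢ q (comp u)
    q-free {u} u∈ e with find (comp u)
    ... | no  ¬a = λ eq → ¬a (u , (u∈ , e , eq) , refl)
    ... | yes (u′ , a@(_ , e′ , refl) , eq) = λ c≡ →
      κ≢ a (trans (sym c≡) (cong c (sym (neighbour-uniq C e′ e eq))))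

    open Recolour i∈ q q∈ q-free public

  Result : Set
  Result = Extends G K S (S ⊕ v) c

  dominated⇒domIn : ∀ {j} → Dominated G S K c j → ∃ λ l → DomIn l j
  dominated⇒domIn (x , x∈ , eq , dom) = comp x , x , x∈ , refl , eq , dom

  -- Exchanging `i` and `p` in component `l` is harmless if both or neither of them are dominated
  -- there.
  Swappable : Fin n → Fin t → Fin t → Set
  Swappable l i p = p ∈ K × p ≢ i × (DomIn l i → DomIn l p) × (DomIn l p → DomIn l i)

  swappable? : ∀ l i p → Dec (Swappable l i p)
  swappable? l i p = p ∈? K ×-dec ¬? (p ≟ i) ×-dec
    (domIn? l i →-dec domIn? l p) ×-dec (domIn? l p →-dec domIn? l i)

  Stuck : Fin t → Set
  Stuck i = ∃ λ u → Neighbour u i × ¬ ∃ (Swappable (comp u) i)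

  stuck? : ∀ i → Dec (Stuck i)
  stuck? i = any? λ u → neighbour? u i ×-dec ¬? (any? (swappable? (comp u) i))

  -- Every component with a neighbour of `v` coloured `i` admits a harmless exchange. Together these
  -- free `i` for `v`, and no component loses a dominated colour.
  free-colour : ∀ {i} → i ∈ K → ¬ Stuck i → Result
  free-colour {i} i∈ ¬stuck = E.c′ , E.col′ , λ d → let (l , d′) = dominated⇒domIn d in kept d′ (E.q-spec l)
    where
    exchange-with : ∀ {u} → Neighbour u i → ∃ (Swappable (comp u) i)
    exchange-with {u} a = decidable-stable (any? (swappable? (comp u) i)) λ ¬s → ¬stuck (u , a , ¬s)

    module E = Escape i∈ (λ a → proj₁ (exchange-with a)) (λ a → proj₁ (proj₂ (exchange-with a)))
      (λ a → proj₁ (proj₂ (proj₂ (exchange-with a))))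

    kept : ∀ {l j} → DomIn l j →
           E.q l ≡ i ⊎ (∃ λ u → ∃ λ (a : Neighbour u i) → comp u ≡ l × E.q l ≡ proj₁ (exchange-with a)) →
           Dominated G (S ⊕ v) K E.c′ j
    kept {l} {j} d (inj₁ q≡) = subst (Dominated G (S ⊕ v) K E.c′)
      (trans (cong (λ k → transpose i k j) q≡) (transpose-refl i j)) (E.carried d)
    kept {l} {j} d (inj₂ (u , a , refl , q≡)) with j ≟ i
    -- After the exchange `i` is dominated where `p` was before, and conversely.
    ... | yes refl = subst (Dominated G (S ⊕ v) K E.c′)
      (trans (cong (λ k → transpose i k p) q≡) (transpose-right i p)) (E.carried (i⇒p d))
      where
      p = proj₁ (exchange-with a)
      i⇒p = proj₁ (proj₂ (proj₂ (proj₂ (exchange-with a))))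
    ... | no j≢i with j ≟ proj₁ (exchange-with a)
    ... | yes refl = subst (Dominated G (S ⊕ v) K E.c′)
      (trans (cong (λ k → transpose i k i) q≡) (transpose-left i p)) (E.carried (p⇒i d))
      where
      p = proj₁ (exchange-with a)
      p⇒i = proj₂ (proj₂ (proj₂ (proj₂ (exchange-with a))))
    ... | no j≢p = subst (Dominated G (S ⊕ v) K E.c′)
      (trans (cong (λ k → transpose i k j) q≡) (transpose-other j≢i j≢p)) (E.carried d)

  -- Otherwise every colour i occurs at a neighbour of v in whose component
  -- either i is dominated or all the other colours are.
  AllOthers : Fin t → Set
  AllOthers i = ∃ λ u → Neighbour u i × (∀ {p} → p ∈ K → p ≢ i → DomIn (comp u) p)

  Itself : Fin t → Set
  Itself i = ∃ λ u → Neighbour u i × DomIn (comp u) i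

  itself? : ∀ i → Dec (Itself i)
  itself? i = any? λ u → neighbour? u i ×-dec domIn? (comp u) i

  -- If `i` is not dominated in the component, any other undominated colour could be exchanged with
  -- it.
  stuck⇒ : ∀ {i} → Stuck i → ¬ Itself i → AllOthers i
  stuck⇒ {i} (u , a , ¬s) ¬b = u , a , λ {p} p∈ p≢ → decidable-stable (domIn? (comp u) p) λ ¬d →
    ¬s (p , p∈ , p≢ , (λ d → contradiction (u , a , d) ¬b) , λ d → contradiction d ¬d)

  Three : Set
  Three = ∃ λ i → ∃ λ j → ∃ λ k → (i ∈ K × j ∈ K × k ∈ K) × (i ≢ j × i ≢ k × j ≢ k)

  three? : Dec Three
  three? = any? λ i → any? λ j → any? λ k →
    (i ∈? K ×-dec j ∈? K ×-dec k ∈? K) ×-dec (¬? (i ≟ j) ×-dec ¬? (i ≟ k) ×-dec ¬? (j ≟ k))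

  two-others : Three → ∀ i → ∃ λ j → ∃ λ k → (j ∈ K × k ∈ K) × (i ≢ j × i ≢ k × j ≢ k)
  two-others (a , b , d , (a∈ , b∈ , d∈) , a≢b , a≢d , b≢d) i with i ≟ a
  ... | yes refl = b , d , (b∈ , d∈) , a≢b , a≢d , b≢d
  ... | no i≢a with i ≟ b
  ... | yes refl = a , d , (a∈ , d∈) , i≢a , b≢d , a≢d
  ... | no i≢b = a , b , (a∈ , b∈) , i≢a , i≢b , a≢b

  -- The vertex `v` gets a colour `j` other than `i`, and `j` is exchanged with a third colour `k`
  -- where needed. The component of `u₀`, whose colour is `i`, is untouched and dominates all
  -- colours other than `i`; and `i`, which is never moved, stays dominated wherever it was.
  all-others : Three → ∀ {i} → AllOthers i → Result
  all-others three {i} (u₀ , (u₀∈ , e₀ , cu₀) , others) with two-others three i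
  ... | j , k , (j∈ , k∈) , i≢j , i≢k , j≢k =
    E.c′ , E.col′ , λ {p} d → let (l , d′) = dominated⇒domIn d in kept l d d′
    where
    module E = Escape j∈ (λ _ → k) (λ _ → k∈) (λ _ → ≢-sym j≢k)

    kept : ∀ {p} l → Dominated G S K c p → DomIn l p → Dominated G (S ⊕ v) K E.c′ p
    kept {p} l d d′ with p ≟ i
    ... | no p≢i = subst (Dominated G (S ⊕ v) K E.c′)
      (trans (cong (λ q → transpose j q p) (E.untouched e₀ λ eq → i≢j (trans (sym cu₀) eq)))
             (transpose-refl j p))
      (E.carried (others (subst (_∈ K) (proj₁ (proj₂ (proj₂ d))) (within col (proj₁ (proj₂ d)))) p≢i))
    ... | yes refl with E.q-spec l
    ... | inj₁ q≡ = subst (Dominated G (S ⊕ v) K E.c′)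
      (trans (cong (λ q → transpose j q i) q≡) (transpose-other i≢j i≢j)) (E.carried d′)
    ... | inj₂ (_ , _ , _ , q≡) = subst (Dominated G (S ⊕ v) K E.c′)
      (trans (cong (λ q → transpose j q i) q≡) (transpose-other i≢j i≢k)) (E.carried d′)

  -- The vertex `v` gets colour `a`. Each other colour `j` occurs at a neighbour of `v` whose
  -- component is untouched and dominates `j`; and `v`, which sees all these neighbours, dominates
  -- `a`.
  all-itself : Three → (∀ {i} → i ∈ K → Itself i) → Result
  all-itself (a , b , _ , (a∈ , b∈ , _) , a≢b , _) own =
    E.c′ , E.col′ , λ (x , x∈ , eq , _) → all-dominated (subst (_∈ K) eq (within col x∈))
    where
    module E = Escape a∈ (λ _ → b) (λ _ → b∈) (λ _ → ≢-sym a≢b)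

    fixed : ∀ {j u} → Neighbour u j → j ≢ a → ∀ k → E.π (comp u) k ≡ k
    fixed (_ , e , refl) j≢a k = trans (cong (λ q → transpose a q k) (E.untouched e j≢a)) (transpose-refl a k)

    all-dominated : ∀ {j} → j ∈ K → Dominated G (S ⊕ v) K E.c′ j
    all-dominated {j} j∈ with j ≟ a
    ... | yes refl = v , inj₂ refl , E.c′-v , λ {k} k∈ k≢ →
      let (u , nb@(u∈ , e , eq) , _) = own k∈
      in u , inj₁ u∈ , e , trans (E.c′-S u∈) (trans (fixed nb (λ k≡ → k≢ (trans k≡ (sym E.c′-v))) (c u)) eq)
    ... | no j≢a = let (u , nb , d) = own j∈ in
      subst (Dominated G (S ⊕ v) K E.c′) (fixed nb j≢a j) (E.carried d)

  -- With at most two colours any colouring `c₀` will do. If there is a second colour, a vertex `x`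
  -- dominating under `c` has a neighbour in `S`, and under `c₀` the two ends of that edge carry
  -- both colours and see each other.
  few-colours : ¬ Three → Colourable G (S ⊕ v) K → Result
  few-colours ¬three (c₀ , col₀) with any? (dominated? G S K c)
  ... | no  ¬d = c₀ , col₀ , λ {j} d → contradiction (j , d) ¬d
  ... | yes (_ , x , x∈ , _ , dom) =
    c₀ , col₀ , λ (y , y∈ , eq , _) → all-dominated (subst (_∈ K) eq (within col y∈))
    where
    two : ∀ {i j k} → i ∈ K → j ∈ K → k ∈ K → i ≢ j → i ≢ k → j ≡ k
    two {i} {j} {k} i∈ j∈ k∈ i≢j i≢k = decidable-stable (j ≟ k) λ j≢k →
      ¬three (i , j , k , (i∈ , j∈ , k∈) , i≢j , i≢k , j≢k)

    c₀x∈ : c₀ x ∈ K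
    c₀x∈ = within col₀ (inj₁ x∈)

    neighbour : ∀ {k} → k ∈ K → k ≢ c₀ x → ∃ λ w → w ∈ S × Adj G x w
    neighbour {k} k∈ k≢ with k ≟ c x
    ... | no  k≢cx = let (w , w∈ , e , _) = dom k∈ k≢cx in w , w∈ , e
    -- Here `k` is the old colour of `x`, so `c₀ x` is a different colour, which `x` sees under `c`.
    ... | yes refl = let (w , w∈ , e , _) = dom c₀x∈ (≢-sym k≢) in w , w∈ , e

    other : ∀ {k} → k ∈ K → k ≢ c₀ x → ∃ λ w → w ∈ S × Adj G x w × c₀ w ≡ k
    other k∈ k≢ = let (w , w∈ , e) = neighbour k∈ k≢ in
      w , w∈ , e , two c₀x∈ (within col₀ (inj₁ w∈)) k∈ (proper col₀ (inj₁ x∈) (inj₁ w∈) e) (≢-sym k≢)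

    all-dominated : ∀ {j} → j ∈ K → Dominated G (S ⊕ v) K c₀ j
    all-dominated {j} j∈ with j ≟ c₀ x
    ... | yes refl = x , inj₁ x∈ , refl , λ k∈ k≢ →
      let (w , w∈ , e , eq) = other k∈ k≢ in w , inj₁ w∈ , e , eq
    ... | no j≢ = let (w , w∈ , e , eq) = other j∈ j≢ in
      w , inj₁ w∈ , eq , λ k∈ k≢ → x , inj₁ x∈ , symm G e ,
        two j∈ c₀x∈ k∈ j≢ (λ j≡k → k≢ (trans (sym j≡k) (sym eq)))

  result : Colourable G (S ⊕ v) K → Result
  result colourable with three?
  ... | no ¬three = few-colours ¬three colourable
  ... | yes three with any? (λ i → i ∈? K ×-dec ¬? (stuck? i))
  ... | yes (i , i∈ , ¬stuck) = free-colour i∈ ¬stuck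
  ... | no  ¬free with any? (λ i → i ∈? K ×-dec ¬? (itself? i))
  ... | yes (i , i∈ , ¬own) = all-others three
    (stuck⇒ (decidable-stable (stuck? i) λ ¬s → ¬free (i , i∈ , ¬s)) ¬own)
  ... | no  ¬others = all-itself three λ {i} i∈ →
    decidable-stable (itself? i) λ ¬own → ¬others (i , i∈ , ¬own)

components⇒monotone : {n : ℕ} (G : Graph n) → (∀ v → Components G v) → Monotone G
components⇒monotone G C = vertexStep⇒monotone G λ K S v v∉ colourable c col →
  ForestStep.result G S v v∉ K c col (C v) colourable

-- Forests built vertex by vertex, and trees as such forests.

_∈ˡ?_ : {n : ℕ} (v : Fin n) (xs : List (Fin n)) → Dec (v ∈ˡ xs)
_∈ˡ?_ = DecMembership._∈?_ _≟_

-- Newest vertex first.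
data Forest {n : ℕ} (F : Graph n) : List (Fin n) → Set where
  []  : Forest F []
  add : ∀ {x xs} → ¬ x ∈ˡ xs →
        (∀ {u w} → u ∈ˡ xs → w ∈ˡ xs → Adj F x u → Adj F x w → u ≡ w) →
        Forest F xs → Forest F (x ∷ xs)

module _ {n : ℕ} (F : Graph n) where

  -- By `comp∈`, a vertex outside the list is itself a fresh label.
  record ComponentsIn (xs : List (Fin n)) (v : Fin n) : Set where
    field
      comp  : Fin n → Fin n
      comp∈ : ∀ {u} → u ∈ˡ xs → comp u ∈ˡ xs
      edge  : ∀ {u w} → u ∈ˡ xs → w ∈ˡ xs → u ≢ v → w ≢ v → Adj F u w → comp u ≡ comp w
      uniq  : ∀ {u w} → u ∈ˡ xs → w ∈ˡ xs → Adj F v u → Adj F v w → comp u ≡ comp w → u ≡ w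

  -- If `v` is newest it has at most one neighbour, and a single label suffices. Otherwise the
  -- newest vertex `x` joins the component of its older neighbour, if that exists and differs from
  -- `v`; failing that, `x` forms a component of its own, labelled `x`.
  componentsIn : ∀ {xs v} → Forest F xs → v ∈ˡ xs → ComponentsIn xs v
  componentsIn (add {x} {xs} x∉ only _) (here refl) = record
    { comp = const x ; comp∈ = λ _ → here refl ; edge = λ _ _ _ _ _ → refl
    ; uniq = λ u∈ w∈ xu xw _ → only (old u∈ xu) (old w∈ xw) xu xw }
    where
    old : ∀ {u} → u ∈ˡ x ∷ xs → Adj F x u → u ∈ˡ xs
    old (here refl) xu = ⊥-elim (irrefl F refl xu)
    old (there u∈) _ = u∈
  componentsIn {v = v} (add {x} {xs} x∉ only f) (there v∈) =
    extend (any? λ w → w ∈ˡ? xs ×-dec adj? F x w ×-dec ¬? (w ≟ v))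
    where
    open ComponentsIn (componentsIn f v∈)

    ≢x : ∀ {u} → u ∈ˡ xs → u ≢ x
    ≢x u∈ refl = x∉ u∈

    extend : Dec (∃ λ w → w ∈ˡ xs × Adj F x w × w ≢ v) → ComponentsIn (x ∷ xs) v
    extend (yes (p , p∈ , xp , p≢v)) = record
      { comp = comp′ ; comp∈ = c∈ ; edge = e ; uniq = uq }
      where
      comp′ : Fin n → Fin n
      comp′ = comp [ x ≔ comp p ]
      on-x : comp′ x ≡ comp p
      on-x = ≔-same comp
      on-xs : ∀ {u} → u ∈ˡ xs → comp′ u ≡ comp u
      on-xs u∈ = ≔-other comp (≢x u∈)
      c∈ : ∀ {u} → u ∈ˡ x ∷ xs → comp′ u ∈ˡ x ∷ xs
      c∈ (here refl) = subst (_∈ˡ x ∷ xs) (sym on-x) (there (comp∈ p∈))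
      c∈ (there u∈)  = subst (_∈ˡ x ∷ xs) (sym (on-xs u∈)) (there (comp∈ u∈))
      e′ : ∀ {w} → w ∈ˡ xs → Adj F x w → comp′ x ≡ comp′ w
      e′ w∈ xw = trans on-x (trans (cong comp (only p∈ w∈ xp xw)) (sym (on-xs w∈)))
      e : ∀ {u w} → u ∈ˡ x ∷ xs → w ∈ˡ x ∷ xs → u ≢ v → w ≢ v → Adj F u w → comp′ u ≡ comp′ w
      e (here refl) (here refl) _ _ _ = refl
      e (here refl) (there w∈) _ _ xw = e′ w∈ xw
      e (there u∈) (here refl) _ _ ux = sym (e′ u∈ (symm F ux))
      e (there u∈) (there w∈) u≢ w≢ uw = trans (on-xs u∈) (trans (edge u∈ w∈ u≢ w≢ uw) (sym (on-xs w∈)))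
      v≁x : ¬ Adj F v x
      v≁x vx = p≢v (only p∈ v∈ xp (symm F vx))
      uq : ∀ {u w} → u ∈ˡ x ∷ xs → w ∈ˡ x ∷ xs → Adj F v u → Adj F v w → comp′ u ≡ comp′ w → u ≡ w
      uq (here refl) _ vx _ _ = ⊥-elim (v≁x vx)
      uq (there _) (here refl) _ vx _ = ⊥-elim (v≁x vx)
      uq (there u∈) (there w∈) vu vw eq =
        uniq u∈ w∈ vu vw (trans (sym (on-xs u∈)) (trans eq (on-xs w∈)))
    extend (no isolated) = record
      { comp = comp′ ; comp∈ = c∈ ; edge = e ; uniq = uq }
      where
      comp′ : Fin n → Fin n
      comp′ = comp [ x ≔ x ]
      on-x : comp′ x ≡ x
      on-x = ≔-same comp
      on-xs : ∀ {u} → u ∈ˡ xs → comp′ u ≡ comp u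
      on-xs u∈ = ≔-other comp (≢x u∈)
      c∈ : ∀ {u} → u ∈ˡ x ∷ xs → comp′ u ∈ˡ x ∷ xs
      c∈ (here refl) = here on-x
      c∈ (there u∈)  = subst (_∈ˡ x ∷ xs) (sym (on-xs u∈)) (there (comp∈ u∈))
      e : ∀ {u w} → u ∈ˡ x ∷ xs → w ∈ˡ x ∷ xs → u ≢ v → w ≢ v → Adj F u w → comp′ u ≡ comp′ w
      e (here refl) (here refl) _ _ _ = refl
      e (here refl) (there w∈) _ w≢ xw = ⊥-elim (isolated (_ , w∈ , xw , w≢))
      e (there u∈) (here refl) u≢ _ ux = ⊥-elim (isolated (_ , u∈ , symm F ux , u≢))
      e (there u∈) (there w∈) u≢ w≢ uw = trans (on-xs u∈) (trans (edge u∈ w∈ u≢ w≢ uw) (sym (on-xs w∈)))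
      new : ∀ {w} → w ∈ˡ xs → comp′ x ≢ comp′ w
      new w∈ eq = x∉ (subst (_∈ˡ xs) (trans (sym (on-xs w∈)) (trans (sym eq) on-x)) (comp∈ w∈))
      uq : ∀ {u w} → u ∈ˡ x ∷ xs → w ∈ˡ x ∷ xs → Adj F v u → Adj F v w → comp′ u ≡ comp′ w → u ≡ w
      uq (here refl) (here refl) _ _ _ = refl
      uq (here refl) (there w∈) _ _ eq = contradiction eq (new w∈)
      uq (there u∈) (here refl) _ _ eq = contradiction (sym eq) (new u∈)
      uq (there u∈) (there w∈) vu vw eq =
        uniq u∈ w∈ vu vw (trans (sym (on-xs u∈)) (trans eq (on-xs w∈)))

  record SimplePath (xs : List (Fin n)) (u w : Fin n) : Set where
    field
      {last}   : ℕ
      vertex   : Fin (suc last) → Fin n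
      inside   : ∀ i → vertex i ∈ˡ xs
      distinct : Injective _≡_ _≡_ vertex
      step     : ∀ i → Adj F (vertex (inject₁ i)) (vertex (suc i))
      start    : vertex zero ≡ u
      end      : vertex (fromℕ last) ≡ w

  open SimplePath

  trivial : ∀ {xs u} → u ∈ˡ xs → SimplePath xs u u
  trivial {u = u} u∈ = record
    { last = 0 ; vertex = const u ; inside = λ _ → u∈
    ; distinct = λ { {zero} {zero} _ → refl } ; step = λ () ; start = refl ; end = refl }

  ∷-distinct : ∀ {x xs l} {f : Fin l → Fin n} → ¬ x ∈ˡ xs → (∀ i → f i ∈ˡ xs) →
               Injective _≡_ _≡_ f → Injective _≡_ _≡_ (x VF.∷ f)
  ∷-distinct x∉ f∈ inj {zero}  {zero}  _  = refl
  ∷-distinct x∉ f∈ inj {zero}  {suc j} refl = ⊥-elim (x∉ (f∈ j))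
  ∷-distinct x∉ f∈ inj {suc i} {zero}  refl = ⊥-elim (x∉ (f∈ i))
  ∷-distinct x∉ f∈ inj {suc i} {suc j} eq = cong suc (inj eq)

  prepend : ∀ {x xs u w} → ¬ x ∈ˡ xs → Adj F x u → SimplePath xs u w → SimplePath (x ∷ xs) x w
  prepend {x} x∉ xu p = record
    { vertex = x VF.∷ vertex p
    ; inside = λ { zero → here refl ; (suc i) → there (inside p i) }
    ; distinct = ∷-distinct x∉ (inside p) (distinct p)
    ; step = λ { zero → subst (Adj F x) (sym (start p)) xu ; (suc i) → step p i }
    ; start = refl
    ; end = end p }

  weaken : ∀ {x xs u w} → SimplePath xs u w → SimplePath (x ∷ xs) u w
  weaken p = record { vertex = vertex p ; inside = there ∘ inside p ; distinct = distinct p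
    ; step = step p ; start = start p ; end = end p }

  opposite-inject₁ : ∀ {l} (i : Fin l) → opposite (inject₁ i) ≡ suc (opposite i)
  opposite-inject₁ zero    = refl
  opposite-inject₁ (suc i) = cong inject₁ (opposite-inject₁ i)

  reverse : ∀ {xs u w} → SimplePath xs u w → SimplePath xs w u
  reverse p = record
    { vertex = vertex p ∘ opposite
    ; inside = inside p ∘ opposite
    ; distinct = λ {i} {j} eq → trans (sym (opposite-involutive i))
        (trans (cong opposite (distinct p eq)) (opposite-involutive j))
    ; step = λ i → subst (λ k → Adj F (vertex p k) (vertex p (inject₁ (opposite i))))
        (sym (opposite-inject₁ i)) (symm F (step p (opposite i)))
    ; start = end p
    ; end = trans (cong (vertex p) (opposite-involutive zero)) (start p) }

  close-path : ∀ {x xs u w} → ¬ x ∈ˡ xs → Adj F x u → Adj F x w → u ≢ w →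
               SimplePath xs u w → Cycle F
  close-path {x} {u = u} {w} x∉ xu xw u≢w p = record
    -- Distinct ends give the path at least one edge, so that with `x` the cycle has at least three
    -- vertices.
    { long     = s≤s (longer p)
    ; vertex   = x VF.∷ vertex p
    ; distinct = ∷-distinct x∉ (inside p) (distinct p)
    ; step     = λ { zero → subst (Adj F x) (sym (start p)) xu ; (suc i) → step p i }
    ; close    = symm F (subst (Adj F x) (sym (end p)) xw)
    }
    where
    longer : (p : SimplePath _ u w) → 1 ≤ last p
    longer record { last = zero  ; start = refl ; end = refl } = contradiction refl u≢w
    longer record { last = suc _ } = s≤s z≤n

  triangle-free : ¬ Cycle F → ∀ {a b c} → Adj F a b → Adj F b c → ¬ Adj F a c
  triangle-free acyclic {a} {b} {c} ab bc ac = acyclic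
    (close-path {xs = b ∷ c ∷ []} a∉ ab ac (λ { refl → irrefl F refl bc })
      (prepend b∉ bc (trivial (here refl))))
    where
    a∉ : ¬ a ∈ˡ b ∷ c ∷ []
    a∉ (here refl)         = irrefl F refl ab
    a∉ (there (here refl)) = irrefl F refl ac
    b∉ : ¬ b ∈ˡ c ∷ []
    b∉ (here refl) = irrefl F refl bc

  -- The paths turn acyclicity into the condition of `add`: two neighbours of a new vertex among
  -- `xs` would close a cycle with the path between them.
  record Grown (xs : List (Fin n)) : Set where
    field
      forest : Forest F xs
      path   : ∀ {u w} → u ∈ˡ xs → w ∈ˡ xs → SimplePath xs u w

  open Grown

  grow : ¬ Cycle F → ∀ {x p xs} → ¬ x ∈ˡ xs → p ∈ˡ xs → Adj F x p → Grown xs → Grown (x ∷ xs)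
  grow acyclic {x} {p} {xs} x∉ p∈ xp g = record
    { forest = add x∉ (λ {u} {w} u∈ w∈ xu xw → decidable-stable (u ≟ w) λ u≢w →
        acyclic (close-path x∉ xu xw u≢w (path g u∈ w∈))) (forest g)
    ; path = path′ }
    where
    path′ : ∀ {u w} → u ∈ˡ x ∷ xs → w ∈ˡ x ∷ xs → SimplePath (x ∷ xs) u w
    path′ (here refl) (here refl) = trivial (here refl)
    path′ (here refl) (there w∈)  = prepend x∉ xp (path g p∈ w∈)
    path′ (there u∈)  (here refl) = reverse (prepend x∉ xp (path g p∈ u∈))
    path′ (there u∈)  (there w∈)  = weaken (path g u∈ w∈)

  -- Each unlisted vertex of the walk is added right after its predecessor, which is adjacent to it
  -- and already listed.
  grow-along : ¬ Cycle F → ∀ {xs u z} → Star (Adj F) u z → u ∈ˡ xs → Grown xs →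
               ∃ λ ys → Grown ys × z ∈ˡ ys × (∀ {v} → v ∈ˡ xs → v ∈ˡ ys)
  grow-along acyclic ε u∈ g = _ , g , u∈ , id
  grow-along acyclic {xs} (_◅_ {j = u′} e es) u∈ g with u′ ∈ˡ? xs
  ... | yes u′∈ = grow-along acyclic es u′∈ g
  ... | no  u′∉ =
    let (ys , g′ , z∈ , sub) = grow-along acyclic es (here refl) (grow acyclic u′∉ u∈ (symm F e) g)
    in ys , g′ , z∈ , sub ∘ there

  spanning : IsTree F → ∃ λ xs → Forest F xs × (∀ v → v ∈ˡ xs)
  spanning tr with root (IsTree.nonempty tr)
    where
    root : ∀ {l} → 0 < l → Fin l
    root (s≤s _) = zero
  ... | r = let (ys , g , _ , covers) = visit (allFin n) in ys , forest g , λ v → covers (∈-allFin v)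
    where
    visit : ∀ zs → ∃ λ ys → Grown ys × r ∈ˡ ys × (∀ {v} → v ∈ˡ zs → v ∈ˡ ys)
    visit [] = r ∷ [] , record
      { forest = add (λ ()) (λ ()) []
      ; path = λ { (here refl) (here refl) → trivial (here refl) } } , here refl , λ ()
    visit (z ∷ zs) =
      let (ys , g , r∈ , covers) = visit zs
          (ys′ , g′ , z∈ , sub)  = grow-along (IsTree.acyclic tr) (IsTree.connected tr r z) r∈ g
      in ys′ , g′ , sub r∈ , λ { (here refl) → z∈ ; (there v∈) → sub (covers v∈) }

  tree⇒components : IsTree F → ∀ v → Components F v
  tree⇒components tr v =
    let (xs , f , all∈) = spanning tr
        C               = componentsIn f (all∈ v)
    in record
      { component      = ComponentsIn.comp C
      ; edge⇒same      = ComponentsIn.edge C (all∈ _) (all∈ _)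
      ; neighbour-uniq = ComponentsIn.uniq C (all∈ _) (all∈ _) }

-- Co-trees

-- A colour class is a clique of `F`; `triangle` bounds it by two vertices.
module Coforest {n : ℕ} (G : Graph n)
  (triangle : ∀ {a b c} → Adj (complement G) a b → Adj (complement G) b c → ¬ Adj (complement G) a c)
  where

  F : Fin n → Fin n → Set
  F = Adj (complement G)

  F? : ∀ u w → Dec (F u w)
  F? = adj? (complement G)

  F-sym : ∀ {u w} → F u w → F w u
  F-sym = symm (complement G)

  module _ {t : ℕ} (S : DecSet (Fin n)) (c : Fin n → Fin t) where

    -- For `u` in `S`: unmatched, when the two-element colour classes are read as a matching of `F`.
    Alone : Fin n → Set
    Alone u = ∀ {w} → w ∈ S → c w ≡ c u → w ≡ u

    Partner : Fin n → Fin n → Set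
    Partner u p = p ∈ S × p ≢ u × c p ≡ c u

    partner? : ∀ u → Dec (∃ (Partner u))
    partner? u = any? λ p → p ∈? S ×-dec ¬? (p ≟ u) ×-dec c p ≟ c u

    no-partner⇒alone : ∀ {u} → ¬ ∃ (Partner u) → Alone u
    no-partner⇒alone {u} ¬p {w} w∈ eq = decidable-stable (w ≟ u) λ w≢u → ¬p (w , w∈ , w≢u , eq)

    alone? : ∀ u → Dec (Alone u)
    alone? u = map′ no-partner⇒alone (λ al (p , p∈ , p≢ , eq) → p≢ (al p∈ eq)) (¬? (partner? u))

    Blocked : Fin n → Set
    Blocked x = ∃ λ u → u ∈ S × Alone u × F x u

    blocked? : ∀ x → Dec (Blocked x)
    blocked? x = any? λ u → u ∈? S ×-dec alone? u ×-dec F? x u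

    Free : Fin n → Set
    Free x = ¬ Blocked x

    HasFree : Fin t → Set
    HasFree j = ∃ λ x → x ∈ S × c x ≡ j × Free x

    AllFree : DecSet (Fin t) → Set
    AllFree K = ∀ {j} → j ∈ K → HasFree j

    -- z - x = y - u is an augmenting path of length three for the matching
    -- of F formed by the colour classes.
    Link : Fin n → Fin n → Fin n → Fin n → Set
    Link z x y u = (z ∈ S × x ∈ S × y ∈ S × u ∈ S) × (Alone z × Alone u) ×
                   (x ≢ y × c x ≡ c y) × (F z x × F y u)

    link? : ∀ z x y u → Dec (Link z x y u)
    link? z x y u = (z ∈? S ×-dec x ∈? S ×-dec y ∈? S ×-dec u ∈? S) ×-dec (alone? z ×-dec alone? u)
      ×-dec (¬? (x ≟ y) ×-dec c x ≟ c y) ×-dec (F? z x ×-dec F? y u)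

    LinkFrom : Fin n → Set
    LinkFrom z = ∃ λ x → ∃ λ y → ∃ λ u → Link z x y u

    linkFrom? : ∀ z → Dec (LinkFrom z)
    linkFrom? z = any? λ x → any? λ y → any? λ u → link? z x y u

  module _ {t : ℕ} {S : DecSet (Fin n)} {c : Fin n → Fin t} where

    relabel-free : ∀ (σ : Fin t → Fin t) {x} → Free S c x → Free S (σ ∘ c) x
    relabel-free σ free (u , u∈ , al , xu) = free (u , u∈ , (λ w∈ eq → al w∈ (cong σ eq)) , xu)

    fromPairs : {K : DecSet (Fin t)} → (∀ {u} → u ∈ S → c u ∈ K) →
                (∀ {u w} → u ∈ S → w ∈ S → u ≢ w → c u ≡ c w → F u w) → IsColouring G S K c
    within (fromPairs c∈ pairs) = c∈
    proper (fromPairs c∈ pairs) u∈ w∈ e eq =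
      proj₂ (pairs u∈ w∈ (λ u≡w → irrefl G u≡w e) eq) e

  module _ {t : ℕ} {S : DecSet (Fin n)} {c : Fin n → Fin t} {K : DecSet (Fin t)}
    (col : IsColouring G S K c) where

    pair : ∀ {u w} → u ∈ S → w ∈ S → u ≢ w → c u ≡ c w → F u w
    pair u∈ w∈ u≢w eq = u≢w , λ e → proper col u∈ w∈ e eq

    no-three : ∀ {p q r} → p ∈ S → q ∈ S → r ∈ S → p ≢ q → q ≢ r → c p ≡ c q → c q ≡ c r → p ≡ r
    no-three {p} {q} {r} p∈ q∈ r∈ p≢q q≢r pq qr = decidable-stable (p ≟ r) λ p≢r →
      triangle (pair p∈ q∈ p≢q pq) (pair q∈ r∈ q≢r qr) (pair p∈ r∈ p≢r (trans pq qr))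

    recolour : ∀ {x i} → i ∈ K → (∀ {q} → q ∈ S → q ≢ x → c q ≡ i → F x q) →
               IsColouring G S K (c [ x ≔ i ])
    recolour {x} {i} i∈ ok = fromPairs c∈ pairs
      where
      c∈ : ∀ {u} → u ∈ S → (c [ x ≔ i ]) u ∈ K
      c∈ {u} u∈ with u ≟ x
      ... | yes refl = subst (_∈ K) (sym (≔-same c)) i∈
      ... | no  u≢x  = subst (_∈ K) (sym (≔-other c u≢x)) (within col u∈)
      pairs : ∀ {u w} → u ∈ S → w ∈ S → u ≢ w → (c [ x ≔ i ]) u ≡ (c [ x ≔ i ]) w → F u w
      pairs {u} {w} u∈ w∈ u≢w eq with u ≟ x | w ≟ x
      ... | yes refl | yes refl = contradiction refl u≢w
      ... | yes refl | no w≢x = ok w∈ w≢x (trans (sym (≔-other c w≢x)) (trans (sym eq) (≔-same c)))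
      ... | no u≢x | yes refl = F-sym (ok u∈ u≢x (trans (sym (≔-other c u≢x)) (trans eq (≔-same c))))
      ... | no u≢x | no w≢x = pair u∈ w∈ u≢w (trans (sym (≔-other c u≢x)) (trans eq (≔-other c w≢x)))

    -- The colour of an alone vertex `u` can be seen only at `u`, and an `F`-neighbour of `u` is not
    -- adjacent to it in `G`.
    dominating⇒free : ∀ {x} → x ∈ S → DominatingIn G S K c x → Free S c x
    dominating⇒free x∈ dom (u , u∈ , al , x≢u , ¬xu) =
      let (w , w∈ , xw , eq) = dom (within col u∈) (λ eq → x≢u (al x∈ (sym eq)))
      in ¬xu (subst (Adj G _) (al w∈ eq) xw)

    -- If `x` is not adjacent to a vertex `w` of colour `j`, then `w` is not alone, and its partner
    -- is adjacent to `x` because `F` has no triangle.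
    free⇒dominating : Onto G S K c → ∀ {x} → x ∈ S → Free S c x → DominatingIn G S K c x
    free⇒dominating onto {x} x∈ free {j} j∈ j≢ with onto j∈
    ... | w , w∈ , refl with adj? G x w
    ... | yes xw = w , w∈ , xw , refl
    ... | no ¬xw with partner? S c w
    ... | no ¬p = ⊥-elim (free (w , w∈ , no-partner⇒alone S c ¬p , (λ { refl → j≢ refl }) , ¬xw))
    ... | yes (p , p∈ , p≢w , eq) with adj? G x p
    ... | yes xp = p , p∈ , xp , eq
    ... | no ¬xp = ⊥-elim (triangle ((λ { refl → j≢ refl }) , ¬xw) (pair w∈ p∈ (≢-sym p≢w) (sym eq))
             ((λ { refl → j≢ (sym eq) }) , ¬xp))

  -- The path of length one: `b` takes the colour of `a`, and the colour of `b` is saved. No vertex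
  -- becomes alone.
  module Augment₁ {t : ℕ} {S : DecSet (Fin n)} {K : DecSet (Fin t)} {c : Fin n → Fin t}
    (col : IsColouring G S K c) {a b : Fin n} (a∈ : a ∈ S) (b∈ : b ∈ S)
    (al-a : Alone S c a) (al-b : Alone S c b) (ab : F a b) where

    c′ : Fin n → Fin t
    c′ = c [ b ≔ c a ]

    at-b : c′ b ≡ c a
    at-b = ≔-same c

    others : ∀ {p} → p ≢ b → c′ p ≡ c p
    others = ≔-other c

    a≢b : a ≢ b
    a≢b = proj₁ ab

    col′ : IsColouring G S (K ⊖ c b) c′
    col′ = fromPairs c∈ (pair col₁)
      where
      col₁ : IsColouring G S K c′
      col₁ = recolour col (within col a∈) λ q∈ _ eq → subst (F b) (sym (al-a q∈ eq)) (F-sym ab)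
      c∈ : ∀ {u} → u ∈ S → c′ u ∈ K ⊖ c b
      c∈ {u} u∈ = within col₁ u∈ , λ eq → case u ≟ b of λ where
        (yes refl) → a≢b (al-b a∈ (trans (sym at-b) eq))
        (no u≢b) → u≢b (al-b u∈ (trans (sym (others u≢b)) eq))

    alone′ : ∀ {p} → p ∈ S → Alone S c′ p → Alone S c p × p ≢ a × p ≢ b
    alone′ {p} p∈ al = (λ {q} q∈ eq → case q ≟ b of λ where
        (yes refl) → sym (al-b p∈ (sym eq))
        (no q≢b) → al q∈ (trans (others q≢b) (trans eq (sym (others p≢b))))) , p≢a , p≢b
      where
      p≢a : p ≢ a
      p≢a refl = a≢b (sym (al b∈ (trans at-b (sym (others a≢b)))))
      p≢b : p ≢ b
      p≢b refl = a≢b (al a∈ (trans (others a≢b) (sym at-b)))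

    onto′ : Onto G S K c → Onto G S (K ⊖ c b) c′
    onto′ onto (j∈ , j≢) = let (w , w∈ , eq) = onto j∈ in
      w , w∈ , trans (others λ { refl → j≢ (sym eq) }) eq

  -- The matching edge `x y` is replaced by `z x` and `y u`: `z` takes the colour of `x`, and `y`
  -- that of `u`. The colour of `z` is saved, and no vertex becomes alone.
  module Augment₃ {t : ℕ} {S : DecSet (Fin n)} {K : DecSet (Fin t)} {c : Fin n → Fin t}
    (col : IsColouring G S K c) {z x y u : Fin n} (link : Link S c z x y u) where

    z∈ = proj₁ (proj₁ link)
    x∈ = proj₁ (proj₂ (proj₁ link))
    y∈ = proj₁ (proj₂ (proj₂ (proj₁ link)))
    u∈ = proj₂ (proj₂ (proj₂ (proj₁ link)))
    al-z = proj₁ (proj₁ (proj₂ link))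
    al-u = proj₂ (proj₁ (proj₂ link))
    x≢y = proj₁ (proj₁ (proj₂ (proj₂ link)))
    cx≡cy = proj₂ (proj₁ (proj₂ (proj₂ link)))
    zx = proj₁ (proj₂ (proj₂ (proj₂ link)))
    yu = proj₂ (proj₂ (proj₂ (proj₂ link)))

    xy : F x y
    xy = pair col x∈ y∈ x≢y cx≡cy

    z≢x : z ≢ x
    z≢x = proj₁ zx

    z≢y : z ≢ y
    z≢y refl = x≢y (al-z x∈ cx≡cy)

    u≢y : u ≢ y
    u≢y = ≢-sym (proj₁ yu)

    u≢x : u ≢ x
    u≢x refl = x≢y (sym (al-u y∈ (sym cx≡cy)))

    u≢z : u ≢ z
    u≢z refl = triangle zx xy (F-sym yu)

    c₁ c′ : Fin n → Fin t
    c₁ = c [ y ≔ c u ]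
    c′ = c₁ [ z ≔ c x ]

    others : ∀ {p} → p ≢ z → p ≢ y → c′ p ≡ c p
    others p≢z p≢y = trans (≔-other c₁ p≢z) (≔-other c p≢y)

    at-z : c′ z ≡ c x
    at-z = ≔-same c₁

    at-x : c′ x ≡ c x
    at-x = others (≢-sym z≢x) x≢y

    at-y : c′ y ≡ c u
    at-y = trans (≔-other c₁ (≢-sym z≢y)) (≔-same c)

    at-u : c′ u ≡ c u
    at-u = others u≢z u≢y

    col′ : IsColouring G S (K ⊖ c z) c′
    col′ = fromPairs c∈ (pair col₂)
      where
      col₁ : IsColouring G S K c₁
      col₁ = recolour col (within col u∈) λ q∈ _ eq → subst (F y) (sym (al-u q∈ eq)) yu
      -- Once `y` has left its class, `x` is the only vertex other than `z` that can have this
      -- colour.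
      only-x : ∀ {q} → q ∈ S → q ≢ z → c₁ q ≡ c x → F z q
      only-x {q} q∈ q≢z eq with q ≟ y
      ... | yes refl = ⊥-elim (u≢x (sym (al-u x∈ (trans (sym eq) (≔-same c)))))
      ... | no q≢y = subst (F z)
        (sym (no-three col q∈ y∈ x∈ q≢y (≢-sym x≢y) (trans (sym (≔-other c q≢y)) (trans eq cx≡cy)) (sym cx≡cy))) zx
      col₂ : IsColouring G S K c′
      col₂ = recolour col₁ (within col x∈) only-x
      c∈ : ∀ {p} → p ∈ S → c′ p ∈ K ⊖ c z
      c∈ {p} p∈ = within col₂ p∈ , λ eq → case p ≟ z of λ where
        (yes refl) → z≢x (sym (al-z x∈ (trans (sym at-z) eq)))
        (no p≢z) → case p ≟ y of λ where
          (yes refl) → u≢z (al-z u∈ (trans (sym at-y) eq))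
          (no p≢y) → p≢z (al-z p∈ (trans (sym (others p≢z p≢y)) eq))

    alone′ : ∀ {p} → p ∈ S → Alone S c′ p → Alone S c p × p ≢ z
    alone′ {p} p∈ al = al′ , p≢z
      where
      p≢z : p ≢ z
      p≢z refl = z≢x (sym (al x∈ (trans at-x (sym at-z))))
      p≢x : p ≢ x
      p≢x refl = z≢x (al z∈ (trans at-z (sym at-x)))
      p≢y : p ≢ y
      p≢y refl = u≢y (al u∈ (trans at-u (sym at-y)))
      al′ : Alone S c p
      al′ {q} q∈ eq with q ≟ z
      ... | yes refl = sym (al-z p∈ (sym eq))
      ... | no q≢z with q ≟ y
      ... | yes refl = ⊥-elim (p≢x (sym (al x∈ (trans at-x (trans cx≡cy (trans eq (sym (others p≢z p≢y))))))))
      ... | no q≢y = al q∈ (trans (others q≢z q≢y) (trans eq (sym (others p≢z p≢y))))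

    onto′ : Onto G S K c → Onto G S (K ⊖ c z) c′
    onto′ onto (j∈ , j≢) with onto j∈
    ... | w , w∈ , eq with w ≟ y
    ... | yes refl = x , x∈ , trans at-x (trans cx≡cy eq)
    ... | no w≢y = w , w∈ , trans (others (λ { refl → j≢ (sym eq) }) w≢y) eq

    y-blocked : Blocked S c y
    y-blocked = u , u∈ , al-u , yu

  transpose-allFree : {t : ℕ} {K L : DecSet (Fin t)} {S : DecSet (Fin n)} {c : Fin n → Fin t} (i k : Fin t) →
    (∀ {j} → j ∈ L → transpose k i j ∈ K) → AllFree S c K → AllFree S (transpose i k ∘ c) L
  transpose-allFree {S = S} {c} i k τ∈ good j∈ = let (x , x∈ , eq , free) = good (τ∈ j∈) in
    x , x∈ , trans (cong (transpose i k) eq) (transpose-inverse i k) , relabel-free {S = S} {c} (transpose i k) free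

  Reduced : {t : ℕ} → DecSet (Fin t) → Fin t → DecSet (Fin n) → Set
  Reduced K k S = ∃ λ c → IsColouring G S (K ⊖ k) c × AllFree S c (K ⊖ k)

  rename : {t : ℕ} {K : DecSet (Fin t)} {S : DecSet (Fin n)} {i k : Fin t} →
           i ∈ K → k ∈ K → Reduced K i S → Reduced K k S
  rename {K = K} {S} {i} {k} i∈ k∈ (c , col , good) = transpose i k ∘ c ,
    relabel G (transpose i k) (transpose-injective i k) (λ {j} → transpose-⊖ K i∈ k∈ {j}) col ,
    λ {j} → transpose-allFree {K = K ⊖ i} {K ⊖ k} {S} {c} i k (λ {j} → transpose-⊖ K k∈ i∈ {j}) good {j}

  -- Induction on the forest, whose newest vertex `ℓ` has at most one `F`-neighbour in `S`. If that
  -- neighbour is absent or shares the colour of `ℓ`, the class of `ℓ` is peeled off. Otherwise a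
  -- rematching in `Matched` either leads to this case or permits an augmentation that saves a
  -- colour at once.
  reduce : ∀ {xs} → Forest (complement G) xs → ∀ {t} (K : DecSet (Fin t)) {k} → k ∈ K →
           ∀ (S : DecSet (Fin n)) → (∀ {v} → v ∈ S → v ∈ˡ xs) →
           ∀ c → IsColouring G S K c → AllFree S c K → Colourable G S (K ⊖ k) → Reduced K k S
  -- The free vertex of colour `k` would lie in the empty list.
  reduce [] K k∈ S S⊆ c col good _ = case S⊆ (proj₁ (proj₂ (good k∈))) of λ ()
  reduce (add {ℓ} {xs} ℓ∉ only f) {t} K {k} k∈ S S⊆ c col good (c₀ , col₀) with ℓ ∈? S
  ... | no ℓ∉S = reduce f K k∈ S older c col good (c₀ , col₀)
    where
    older : ∀ {v} → v ∈ S → v ∈ˡ xs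
    older v∈ with S⊆ v∈
    ... | here refl = contradiction v∈ ℓ∉S
    ... | there v∈xs = v∈xs
  ... | yes ℓ∈ = by-neighbour (any? λ w → w ∈? S ×-dec F? ℓ w)
    where
    older : ∀ {v} → v ∈ S → v ≢ ℓ → v ∈ˡ xs
    older v∈ v≢ with S⊆ v∈
    ... | here v≡ = contradiction v≡ v≢
    ... | there v∈xs = v∈xs

    leaf : ∀ {u w} → u ∈ S → w ∈ S → F ℓ u → F ℓ w → u ≡ w
    leaf u∈ w∈ ℓu ℓw = only (older u∈ (≢-sym (proj₁ ℓu))) (older w∈ (≢-sym (proj₁ ℓw))) ℓu ℓw

    i₀ : Fin t
    i₀ = c₀ ℓ

    i₀∈ : i₀ ∈ K
    i₀∈ = proj₁ (within col₀ ℓ∈)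

    -- The class of ℓ is removed, after renaming its colour to that of ℓ in c₀.
    peel : ∀ c → IsColouring G S K c → AllFree S c K →
           (∀ {p} → p ∈ S → F ℓ p → c p ≡ c ℓ) → Reduced K k S
    peel c col good same = c⁺ , col⁺ , λ {j} → good⁺ {j}
      where
      P = record { El = λ p → c p ≡ c ℓ ; el? = λ p → c p ≟ c ℓ }
      S′ = S ∖ P
      K′ = K ⊖ i₀
      σ = transpose (c ℓ) i₀

      σ-col : IsColouring G S′ K′ (σ ∘ c)
      within σ-col {p} (p∈ , p∉P) = transpose-⊖ K (within col ℓ∈) i₀∈ {c p} (within col p∈ , p∉P)
      proper σ-col (p∈ , _) (q∈ , _) e eq = proper col p∈ q∈ e (transpose-injective (c ℓ) i₀ eq)

      good′ : AllFree S′ c (K ⊖ c ℓ)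
      good′ (j∈ , j≢) = let (p , p∈ , eq , free) = good j∈ in
        p , (p∈ , λ p∈P → j≢ (trans (sym eq) p∈P)) , eq ,
        λ (u , (u∈ , u∉P) , al , pu) →
          free (u , u∈ , (λ q∈ q≡u → al (q∈ , λ q∈P → u∉P (trans (sym q≡u) q∈P)) q≡u) , pu)

      -- A vertex that `c₀` colours `i₀` is `ℓ` or an `F`-neighbour of `ℓ`, hence in `P`; so `c₀`
      -- does not use `i₀` on `S′`.
      col₀′ : IsColouring G S′ (K′ ⊖ k) c₀
      within col₀′ (p∈ , p∉P) = (proj₁ (within col₀ p∈) , λ eq → p∉P (same p∈
        (pair col₀ ℓ∈ p∈ (λ { refl → p∉P refl }) (sym eq)))) , proj₂ (within col₀ p∈)
      proper col₀′ (p∈ , _) (q∈ , _) = proper col₀ p∈ q∈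

      smaller : Reduced K′ k S′
      smaller = reduce f K′ (k∈ , ≢-sym (proj₂ (within col₀ ℓ∈))) S′
        (λ (v∈ , v∉P) → older v∈ λ { refl → v∉P refl })
        (σ ∘ c) σ-col
        (λ {j} → transpose-allFree {K = K ⊖ c ℓ} {K′} {S′} {c} (c ℓ) i₀
          (λ {j} → transpose-⊖ K i₀∈ (within col ℓ∈) {j}) good′ {j})
        (c₀ , col₀′)

      c₁ = proj₁ smaller
      col₁ = proj₁ (proj₂ smaller)

      c⁺ : Fin n → Fin t
      c⁺ p with p ∈? P
      ... | yes _ = i₀
      ... | no  _ = c₁ p

      on-P : ∀ {p} → p ∈ P → c⁺ p ≡ i₀
      on-P {p} p∈P with p ∈? P
      ... | yes _ = refl
      ... | no p∉P = contradiction p∈P p∉P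

      off-P : ∀ {p} → ¬ p ∈ P → c⁺ p ≡ c₁ p
      off-P {p} p∉P with p ∈? P
      ... | yes p∈P = contradiction p∈P p∉P
      ... | no _ = refl

      apart : ∀ {p q} → p ∈ P → q ∈ S′ → c⁺ p ≢ c⁺ q
      apart p∈P q∈′@(_ , q∉P) eq = proj₂ (proj₁ (within col₁ q∈′))
        (trans (sym (off-P q∉P)) (trans (sym eq) (on-P p∈P)))

      col⁺ : IsColouring G S (K ⊖ k) c⁺
      col⁺ = fromPairs c∈ pairs
        where
        c∈ : ∀ {p} → p ∈ S → c⁺ p ∈ K ⊖ k
        c∈ {p} p∈ = case p ∈? P of λ where
          (yes p∈P) → subst (_∈ K ⊖ k) (sym (on-P p∈P)) (within col₀ ℓ∈)
          (no p∉P) → let ((i∈ , _) , i≢k) = within col₁ (p∈ , p∉P) in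
            subst (_∈ K ⊖ k) (sym (off-P p∉P)) (i∈ , i≢k)
        pairs : ∀ {p q} → p ∈ S → q ∈ S → p ≢ q → c⁺ p ≡ c⁺ q → F p q
        pairs {p} {q} p∈ q∈ p≢q eq = by (p ∈? P) (q ∈? P)
          where
          by : Dec (p ∈ P) → Dec (q ∈ P) → F p q
          by (yes p∈P) (yes q∈P) = pair col p∈ q∈ p≢q (trans p∈P (sym q∈P))
          by (yes p∈P) (no q∉P) = contradiction eq (apart p∈P (q∈ , q∉P))
          by (no p∉P) (yes q∈P) = contradiction (sym eq) (apart q∈P (p∈ , p∉P))
          by (no p∉P) (no q∉P) = pair col₁ (p∈ , p∉P) (q∈ , q∉P) p≢q
            (trans (sym (off-P p∉P)) (trans eq (off-P q∉P)))

      good⁺ : AllFree S c⁺ (K ⊖ k)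
      good⁺ {j} (j∈ , j≢k) with j ≟ i₀
      -- All `F`-neighbours of `ℓ` in `S` share its class, so none of them is alone.
      ... | yes refl = ℓ , ℓ∈ , on-P refl , λ (u , u∈ , al , ℓu) →
        proj₁ ℓu (al ℓ∈ (trans (on-P refl) (sym (on-P (same u∈ ℓu)))))
      ... | no j≢i₀ with proj₂ (proj₂ smaller) ((j∈ , j≢i₀) , j≢k)
      ... | p , (p∈ , p∉P) , eq , free = p , p∈ , trans (off-P p∉P) eq , free⁺
        where
        free⁺ : Free S c⁺ p
        free⁺ (u , u∈ , al , pu) = case u ∈? P of λ where
          (yes u∈P) → p∉P (same p∈ (F-sym (subst (F p)
            (sym (al ℓ∈ (trans (on-P refl) (sym (on-P u∈P))))) pu)))
          (no u∉P) → free (u , (u∈ , u∉P) , (λ (q∈ , q∉P) q≡u →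
            al q∈ (trans (off-P q∉P) (trans q≡u (sym (off-P u∉P))))) , pu)

    -- As `w` is the only `F`-neighbour of `ℓ` in `S`, the vertex `ℓ` is alone and blocks `w`. Hence
    -- `w` has a partner `z`. The colouring `c₂` rematches `w` with `ℓ`, which makes `z` alone
    -- instead of `ℓ`.
    module Matched {w : Fin n} (w∈ : w ∈ S) (ℓw : F ℓ w) (cℓ≢cw : c ℓ ≢ c w) where

      al-ℓ : Alone S c ℓ
      al-ℓ {q} q∈ eq = decidable-stable (q ≟ ℓ) λ q≢ℓ → cℓ≢cw (trans (sym eq) (cong c
        (leaf q∈ w∈ (pair col ℓ∈ q∈ (≢-sym q≢ℓ) (sym eq)) ℓw)))

      ℓ≢w : ℓ ≢ w
      ℓ≢w = proj₁ ℓw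

      w-blocked : Blocked S c w
      w-blocked = ℓ , ℓ∈ , al-ℓ , F-sym ℓw

      -- The free vertex of the colour of w is its partner z.
      witness : HasFree S c (c w)
      witness = good (within col w∈)

      z = proj₁ witness
      z∈ = proj₁ (proj₂ witness)
      cz≡cw = proj₁ (proj₂ (proj₂ witness))
      z-free = proj₂ (proj₂ (proj₂ witness))

      z≢w : z ≢ w
      z≢w z≡w = z-free (subst (Blocked S c) (sym z≡w) w-blocked)

      z≢ℓ : z ≢ ℓ
      z≢ℓ z≡ℓ = cℓ≢cw (trans (cong c (sym z≡ℓ)) cz≡cw)

      c₂ : Fin n → Fin t
      c₂ = c [ w ≔ c ℓ ]

      at-w : c₂ w ≡ c ℓ
      at-w = ≔-same c

      others : ∀ {p} → p ≢ w → c₂ p ≡ c p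
      others = ≔-other c

      at-ℓ : c₂ ℓ ≡ c ℓ
      at-ℓ = others ℓ≢w

      col₂ : IsColouring G S K c₂
      col₂ = recolour col (within col ℓ∈) λ q∈ _ eq → subst (F w) (sym (al-ℓ q∈ eq)) (F-sym ℓw)

      ¬al-w : ¬ Alone S c₂ w
      ¬al-w al = ℓ≢w (al ℓ∈ (trans at-ℓ (sym at-w)))

      ℓ-free : Free S c₂ ℓ
      ℓ-free (u , u∈ , al , ℓu) = ¬al-w (subst (Alone S c₂) (leaf u∈ w∈ ℓu ℓw) al)

      alone₂ : ∀ {p} → p ∈ S → p ≢ z → Alone S c₂ p → Alone S c p
      alone₂ {p} p∈ p≢z al {q} q∈ eq with p ≟ w | q ≟ w
      ... | yes refl | _ = ⊥-elim (¬al-w al)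
      ... | no p≢w | yes refl = contradiction
        (sym (al z∈ (trans (others z≢w) (trans cz≡cw (trans eq (sym (others p≢w))))))) p≢z
      ... | no p≢w | no q≢w = al q∈ (trans (others q≢w) (trans eq (sym (others p≢w))))

      al-z : Alone S c₂ z
      al-z {q} q∈ eq with q ≟ w
      ... | yes refl = contradiction (sym (trans (sym at-w) (trans eq (trans (others z≢w) cz≡cw)))) (≢-sym cℓ≢cw)
      ... | no q≢w = no-three col q∈ w∈ z∈ q≢w (≢-sym z≢w)
        (trans (sym (others q≢w)) (trans eq (trans (others z≢w) cz≡cw))) (sym cz≡cw)

      -- Augmenting from `z` saves its colour. A free vertex of a remaining colour other than that
      -- of `ℓ` keeps its colour: it is not `y`, which `u` blocked already under `c`. The colour of
      -- `ℓ` is free at `ℓ`, whose only `F`-neighbour `w` is not alone.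
      linked : ∀ {x y u} → Link S c₂ z x y u → Reduced K k S
      linked {x} {y} {u} link =
        rename {K = K} {S} (subst (_∈ K) (sym (others z≢w)) (within col z∈)) k∈
          (A.c′ , A.col′ , λ {j} → good′ {j})
        where
        module A = Augment₃ col₂ link

        y≢ℓ : y ≢ ℓ
        y≢ℓ refl = ¬al-w (subst (Alone S c₂) (leaf A.u∈ w∈ A.yu ℓw) A.al-u)

        u-alone : Alone S c u
        u-alone = alone₂ A.u∈ A.u≢z A.al-u

        good′ : AllFree S A.c′ (K ⊖ c₂ z)
        good′ {j} (j∈ , j≢cz) with j ≟ c ℓ
        ... | yes refl = ℓ , ℓ∈ , trans (A.others (≢-sym z≢ℓ) (≢-sym y≢ℓ)) at-ℓ ,
          λ (q , q∈ , al , ℓq) → ℓ-free (q , q∈ , proj₁ (A.alone′ q∈ al) , ℓq)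
        ... | no j≢cℓ with good j∈
        ... | p , p∈ , refl , free = p , p∈ , trans (A.others p≢z p≢y) (others p≢w) ,
          λ (q , q∈ , al , pq) → let (al₂ , q≢z) = A.alone′ q∈ al in
            free (q , q∈ , alone₂ q∈ q≢z al₂ , pq)
          where
          p≢z : p ≢ z
          p≢z p≡z = j≢cz (trans (cong c p≡z) (sym (others z≢w)))
          p≢y : p ≢ y
          p≢y p≡y = free (u , A.u∈ , u-alone , subst (λ r → F r u) (sym p≡y) A.yu)
          p≢w : p ≢ w
          p≢w p≡w = j≢cz (trans (cong c p≡w) (trans (sym cz≡cw) (sym (others z≢w))))

      -- Only `z` has become alone, so only its `F`-neighbours `p` can have become blocked. Such a
      -- `p` has a partner, for otherwise it would have blocked `z` under `c`; and the partner is
      -- free, for otherwise a link would start at `z`.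
      unlinked : ¬ LinkFrom S c₂ z → AllFree S c₂ K
      unlinked ¬link {j} j∈ with j ≟ c ℓ | j ≟ c w
      ... | yes refl | _ = ℓ , ℓ∈ , at-ℓ , ℓ-free
      ... | no _ | yes refl = z , z∈ , trans (others z≢w) cz≡cw , λ (u , u∈ , al , zu) →
        z-free (u , u∈ , alone₂ u∈ (≢-sym (proj₁ zu)) al , zu)
      ... | no _ | no j≢cw with good j∈
      ... | p , p∈ , refl , free = by (F? p z)
        where
        c₂p : c₂ p ≡ c p
        c₂p = others λ { refl → j≢cw refl }

        by : Dec (F p z) → HasFree S c₂ (c p)
        by (no ¬pz) = p , p∈ , c₂p , λ (u , u∈ , al , pu) →
          free (u , u∈ , alone₂ u∈ (λ { refl → ¬pz pu }) al , pu)
        by (yes pz) with partner? S c₂ p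
        ... | no ¬p = ⊥-elim (z-free (p , p∈ , alone₂ p∈ (proj₁ pz) (no-partner⇒alone S c₂ ¬p) , F-sym pz))
        ... | yes (q , q∈ , q≢p , eq) = q , q∈ , trans eq c₂p , λ (u , u∈ , al , qu) →
          ¬link (p , q , u , (z∈ , p∈ , q∈ , u∈) , (al-z , al) , (≢-sym q≢p , sym eq) , (F-sym pz , qu))

      reduced : Reduced K k S
      reduced with linkFrom? S c₂ z
      ... | yes (x , y , u , link) = linked link
      ... | no ¬link = peel c₂ col₂ (λ {j} → unlinked ¬link {j}) λ {p} p∈ ℓp →
        trans (cong c₂ (leaf p∈ w∈ ℓp ℓw)) (trans at-w (sym at-ℓ))

    by-neighbour : Dec (∃ λ w → w ∈ S × F ℓ w) → Reduced K k S
    by-neighbour (no isolated) = peel c col good λ p∈ ℓp → ⊥-elim (isolated (_ , p∈ , ℓp))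
    by-neighbour (yes (w , w∈ , ℓw)) with c w ≟ c ℓ
    ... | yes eq = peel c col good λ p∈ ℓp → trans (cong c (leaf p∈ w∈ ℓp ℓw)) eq
    ... | no neq = Matched.reduced w∈ ℓw (≢-sym neq)

-- Adding a vertex to a co-tree.

module CoforestStep {n : ℕ} (G : Graph n)
  (triangle : ∀ {a b c} → Adj (complement G) a b → Adj (complement G) b c → ¬ Adj (complement G) a c)
  {xs : List (Fin n)} (forest : Forest (complement G) xs) (all∈ : ∀ v → v ∈ˡ xs) where

  open Coforest G triangle

  module Exchange {t : ℕ} (K : DecSet (Fin t)) (S : DecSet (Fin n)) (c : Fin n → Fin t)
    (col : IsColouring G S K c) (onto : Onto G S K c) {v : Fin n} (v∈ : v ∈ S)
    (al-v : Alone S c v) (colourable : Colourable G S (K ⊖ c v)) where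

    k : Fin t
    k = c v

    -- Colours with a free vertex when `v` is ignored; in `NewColour` these include all colours
    -- dominated before `v` was added.
    FreeBut : Fin t → Set
    FreeBut j = ∃ λ x → x ∈ S × x ≢ v × c x ≡ j × (∀ {u} → u ∈ S → u ≢ v → Alone S c u → ¬ F x u)

    Exchanged : Set
    Exchanged = ∃ λ c′ → IsColouring G S (K ⊖ k) c′ × Onto G S (K ⊖ k) c′ ×
                (∀ {j} → FreeBut j → HasFree S c′ j)

    alone-neighbour : Blocked S c v → Exchanged
    alone-neighbour (u , u∈ , al-u , vu) = A.c′ , A.col′ , (λ {j} → A.onto′ onto {j}) ,
      λ (x , x∈ , x≢v , eq , free) → x , x∈ , trans (A.others x≢v) eq ,
        λ (q , q∈ , al , xq) → let (al′ , _ , q≢v) = A.alone′ q∈ al in free q∈ q≢v al′ xq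
      where
      module A = Augment₁ col u∈ v∈ al-u al-v (F-sym vu)

    link-from-v : LinkFrom S c v → Exchanged
    link-from-v (_ , y , u , link) = A.c′ , A.col′ , (λ {j} → A.onto′ onto {j}) ,
      λ (x , x∈ , x≢v , eq , free) → x , x∈ ,
        -- The vertex `y` changes colour, but it is no witness: it has the alone `F`-neighbour `u`,
        -- which is not `v`.
        trans (A.others x≢v λ { refl → free A.u∈ A.u≢z A.al-u A.yu }) eq ,
        λ (q , q∈ , al , xq) → let (al′ , q≢v) = A.alone′ q∈ al in free q∈ q≢v al′ xq
      where
      module A = Augment₃ col link

    module _ (v-free : Free S c v) (no-link : ¬ LinkFrom S c v) where

      -- Only `v` can block the witness `x`. In that case `x` has a partner because `v` is free, and
      -- the partner is free because no link starts at `v`.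
      free-of-colour : ∀ {j} → FreeBut j → HasFree S c j
      free-of-colour (x , x∈ , _ , refl , free) with F? x v
      ... | no ¬xv = x , x∈ , refl , λ (u , u∈ , al , xu) → free u∈ (λ { refl → ¬xv xu }) al xu
      ... | yes xv with partner? S c x
      ... | no ¬p = ⊥-elim (v-free (x , x∈ , no-partner⇒alone S c ¬p , F-sym xv))
      ... | yes (y , y∈ , y≢x , eq) = y , y∈ , eq , λ (u , u∈ , al , yu) →
        no-link (x , y , u , (v∈ , x∈ , y∈ , u∈) , (al-v , al) , (≢-sym y≢x , sym eq) , (F-sym xv , yu))

      -- An augmentation that leaves `v` in place saves some colour `e` instead of `k`. Swapping the
      -- two names gives `v` the colour `e`, and `v` is then the free vertex of that colour.
      exchange : ∀ {e} → e ∈ K → ∀ c′ → IsColouring G S (K ⊖ e) c′ → Onto G S (K ⊖ e) c′ → c′ v ≡ k →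
                 (∀ {p} → p ∈ S → Alone S c′ p → Alone S c p) →
                 (∀ {x} → Free S c x → c x ≢ e → c′ x ≡ c x) → Exchanged
      exchange {e} e∈ c′ col′ onto′ c′v alone′ keep = transpose e k ∘ c′ ,
        relabel G (transpose e k) (transpose-injective e k)
          (λ {j} → transpose-⊖ K e∈ (within col v∈) {j}) col′ ,
        (λ {j} j∈ → let (w , w∈ , eq) = onto′ (transpose-⊖ K (within col v∈) e∈ {j} j∈)
                    in w , w∈ , trans (cong (transpose e k) eq) (transpose-inverse e k)) ,
        λ d → has-free (free-of-colour d) (colour≢k d)
        where
        colour≢k : ∀ {j} → FreeBut j → j ≢ k
        colour≢k (x , x∈ , x≢v , refl , _) eq = x≢v (al-v x∈ eq)

        still-free : ∀ {x} → Free S c x → Free S (transpose e k ∘ c′) x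
        still-free free = relabel-free {S = S} {c′} (transpose e k)
          λ (u , u∈ , al , xu) → free (u , u∈ , alone′ u∈ al , xu)

        has-free : ∀ {j} → HasFree S c j → j ≢ k → HasFree S (transpose e k ∘ c′) j
        has-free {j} (x , x∈ , refl , free) j≢k with j ≟ e
        ... | yes refl = v , v∈ , trans (cong (transpose e k) c′v) (transpose-right e k) , still-free v-free
        ... | no j≢e = x , x∈ ,
          trans (cong (transpose e k) (keep free j≢e)) (transpose-other j≢e j≢k) , still-free free

      alone-edge : ∀ {a b} → a ∈ S → b ∈ S → Alone S c a → Alone S c b → F a b → Exchanged
      alone-edge {a} {b} a∈ b∈ al-a al-b ab =
        exchange (within col b∈) A.c′ A.col′ (λ {j} → A.onto′ onto {j})
          (A.others λ { refl → v-free (a , a∈ , al-a , F-sym ab) })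
          (λ p∈ al → proj₁ (A.alone′ p∈ al))
          (λ free _ → A.others λ { refl → free (a , a∈ , al-a , F-sym ab) })
        where
        module A = Augment₁ col a∈ b∈ al-a al-b ab

      link : ∀ {z} → LinkFrom S c z → Exchanged
      link {z} (x , y , u , l) =
        exchange (within col A.z∈) A.c′ A.col′ (λ {j} → A.onto′ onto {j})
          (A.others (λ { refl → no-link (x , y , u , l) }) (λ { refl → A.x≢y (al-v A.x∈ A.cx≡cy) }))
          (λ p∈ al → proj₁ (A.alone′ p∈ al))
          (λ free ≢e → A.others (λ { refl → ≢e refl }) (λ { refl → free A.y-blocked }))
        where
        module A = Augment₃ col l

    -- A blocked vertex `w` has a partner, since two alone vertices are never `F`-adjacent; if the
    -- partner were blocked too, the two blocking vertices would be the ends of a link.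
    all-free : ¬ (∃ λ a → a ∈ S × Alone S c a × Blocked S c a) → ¬ ∃ (LinkFrom S c) → AllFree S c K
    all-free no-edge no-link j∈ with onto j∈
    ... | w , w∈ , refl with blocked? S c w
    ... | no free = w , w∈ , refl , free
    ... | yes b@(u , u∈ , al-u , wu) with partner? S c w
    ... | no ¬p = ⊥-elim (no-edge (w , w∈ , no-partner⇒alone S c ¬p , b))
    ... | yes (p , p∈ , p≢w , eq) = p , p∈ , eq , λ (u′ , u′∈ , al-u′ , pu′) →
      no-link (u , w , p , u′ , (u∈ , w∈ , p∈ , u′∈) , (al-u , al-u′) ,
        (≢-sym p≢w , sym eq) , (F-sym wu , pu′))

    exchanged : Exchanged
    exchanged with blocked? S c v
    ... | yes b = alone-neighbour b
    ... | no v-free with linkFrom? S c v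
    ... | yes l = link-from-v l
    ... | no no-link with any? (λ a → a ∈? S ×-dec alone? S c a ×-dec blocked? S c a)
    ... | yes (a , a∈ , al-a , b , b∈ , al-b , ab) = alone-edge v-free no-link a∈ b∈ al-a al-b ab
    ... | no no-edge with any? (linkFrom? S c)
    ... | yes (_ , l) = link v-free no-link l
    ... | no ¬links =
      let (c′ , col′ , good) = reduce forest K (within col v∈) S (λ _ → all∈ _) c col
                                 (λ {j} → all-free no-edge ¬links {j}) colourable
      in c′ , col′ , (λ j∈ → let (x , x∈ , eq , _) = good j∈ in x , x∈ , eq) ,
         λ (x , x∈ , x≢v , eq , _) → good (subst (_∈ K ⊖ k) eq (within col x∈ , λ eq′ → x≢v (al-v x∈ eq′)))

  -- v gets a colour of its own, which Exchange then eliminates.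
  module NewColour {t : ℕ} (K : DecSet (Fin t)) (S : DecSet (Fin n)) (v : Fin n) (v∉S : ¬ v ∈ S)
    (c₀ : Fin n → Fin t) (col₀ : IsColouring G (S ⊕ v) K c₀)
    (c : Fin n → Fin t) (col : IsColouring G S K c) (onto : Onto G S K c) where

    S′ : DecSet (Fin n)
    S′ = S ⊕ v

    El⁺ : Fin (suc t) → Set
    El⁺ zero    = ⊤
    El⁺ (suc j) = j ∈ K

    el⁺? : ∀ j → Dec (El⁺ j)
    el⁺? zero    = yes tt
    el⁺? (suc j) = j ∈? K

    K⁺ : DecSet (Fin (suc t))
    K⁺ = record { El = El⁺ ; el? = el⁺? }

    c⁺ : Fin n → Fin (suc t)
    c⁺ = (suc ∘ c) [ v ≔ zero ]

    at-v : c⁺ v ≡ zero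
    at-v = ≔-same (suc ∘ c)

    at-S : ∀ {w} → w ∈ S → c⁺ w ≡ suc (c w)
    at-S w∈ = ≔-other (suc ∘ c) λ { refl → v∉S w∈ }

    zero≢suc : ∀ {j : Fin t} → zero ≢ suc j
    zero≢suc ()

    apart : ∀ {w} → w ∈ S → c⁺ v ≢ c⁺ w
    apart w∈ eq = zero≢suc (trans (sym at-v) (trans eq (at-S w∈)))

    col⁺ : IsColouring G S′ K⁺ c⁺
    within col⁺ (inj₁ w∈) = subst El⁺ (sym (at-S w∈)) (within col w∈)
    within col⁺ (inj₂ refl) = subst El⁺ (sym at-v) tt
    proper col⁺ (inj₁ a∈) (inj₁ b∈) e eq = proper col a∈ b∈ e
      (suc-injective (trans (sym (at-S a∈)) (trans eq (at-S b∈))))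
    proper col⁺ (inj₁ a∈) (inj₂ refl) e eq = apart a∈ (sym eq)
    proper col⁺ (inj₂ refl) (inj₁ b∈) e eq = apart b∈ eq
    proper col⁺ (inj₂ refl) (inj₂ refl) e eq = irrefl G refl e

    onto⁺ : Onto G S′ K⁺ c⁺
    onto⁺ {zero}  _  = v , inj₂ refl , at-v
    onto⁺ {suc j} j∈ = let (w , w∈ , eq) = onto j∈ in w , inj₁ w∈ , trans (at-S w∈) (cong suc eq)

    alone-v : Alone S′ c⁺ v
    alone-v (inj₁ w∈) eq = ⊥-elim (apart w∈ (sym eq))
    alone-v (inj₂ w≡v) _ = w≡v

    colourable⁺ : Colourable G S′ (K⁺ ⊖ c⁺ v)
    colourable⁺ = suc ∘ c₀ , record
      { within = λ w∈ → within col₀ w∈ , λ eq → zero≢suc (sym (trans eq at-v))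
      ; proper = λ u∈ w∈ e eq → proper col₀ u∈ w∈ e (suc-injective eq) }

    open Exchange K⁺ S′ c⁺ col⁺ (λ {j} → onto⁺ {j}) (inj₂ refl) alone-v colourable⁺

    c′ : Fin n → Fin (suc t)
    c′ = proj₁ exchanged

    col′ : IsColouring G S′ (K⁺ ⊖ c⁺ v) c′
    col′ = proj₁ (proj₂ exchanged)

    lower : Fin t → Fin (suc t) → Fin t
    lower d zero    = d
    lower d (suc j) = j

    suc-lower : ∀ {d} {j : Fin (suc t)} → j ≢ zero → suc (lower d j) ≡ j
    suc-lower {j = zero}  j≢ = contradiction refl j≢
    suc-lower {j = suc j} _  = refl

    c″ : Fin n → Fin t
    -- The default `c w` is never taken on `S′`, where `zero` no longer occurs.
    c″ w = lower (c w) (c′ w)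

    suc-c″ : ∀ {w} → w ∈ S′ → suc (c″ w) ≡ c′ w
    suc-c″ w∈ = suc-lower λ eq → proj₂ (within col′ w∈) (trans eq (sym at-v))

    col″ : IsColouring G S′ K c″
    within col″ w∈ = subst El⁺ (sym (suc-c″ w∈)) (proj₁ (within col′ w∈))
    proper col″ u∈ w∈ e eq = proper col′ u∈ w∈ e
      (trans (sym (suc-c″ u∈)) (trans (cong suc eq) (suc-c″ w∈)))

    onto″ : Onto G S′ K c″
    onto″ j∈ =
      let (w , w∈ , eq) = proj₁ (proj₂ (proj₂ exchanged)) (j∈ , λ eq → zero≢suc (sym (trans eq at-v)))
      in w , w∈ , suc-injective (trans (suc-c″ w∈) eq)

    -- A dominating `x` is free in `S`, so its colour is `FreeBut` for `c⁺`. The exchange provides a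
    -- free `y` of that colour, which is dominating because the new colouring is onto.
    dominated″ : ∀ {j} → Dominated G S K c j → Dominated G S′ K c″ j
    dominated″ {j} (x , x∈ , eq , dom) = y , y∈ , suc-injective (trans (suc-c″ y∈) c′y) ,
      λ {i} → free⇒dominating col″ (λ {i} → onto″ {i}) y∈ (λ (u , u∈ , al , yu) → y-free (u , u∈ ,
        (λ w∈ eq → al w∈ (suc-injective (trans (suc-c″ w∈) (trans eq (sym (suc-c″ u∈)))))) , yu)) {i}
      where
      x-free : ∀ {u} → u ∈ S′ → u ≢ v → Alone S′ c⁺ u → ¬ F x u
      x-free (inj₁ u∈) _ al xu = dominating⇒free col x∈ dom
        (_ , u∈ , (λ w∈ eq → al (inj₁ w∈) (trans (at-S w∈) (trans (cong suc eq) (sym (at-S u∈))))) , xu)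
      x-free (inj₂ u≡v) u≢v _ _ = u≢v u≡v

      found : HasFree S′ c′ (suc j)
      found = proj₂ (proj₂ (proj₂ exchanged))
        (x , inj₁ x∈ , (λ { refl → v∉S x∈ }) , trans (at-S x∈) (cong suc eq) , λ {u} → x-free {u})

      y = proj₁ found
      y∈ = proj₁ (proj₂ found)
      c′y = proj₁ (proj₂ (proj₂ found))
      y-free = proj₂ (proj₂ (proj₂ found))

  vertexStep : VertexStep G
  vertexStep K S v v∉ (c₀ , col₀) c col with unused⊎onto G S K c
  ... | inj₁ (j , j∈ , unused) = c₀ , col₀ , λ d → contradiction (dominated⇒onto G S {K} d j∈) unused
  ... | inj₂ onto = N.c″ , N.col″ , λ {j} → N.dominated″ {j}
    where
    module N = NewColour K S v v∉ c₀ col₀ c col (λ {j} → onto {j})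

tree⇒monotone : {n : ℕ} (G : Graph n) → IsTree G → Monotone G
tree⇒monotone G tr = components⇒monotone G (tree⇒components G tr)

cotree⇒monotone : {n : ℕ} (G : Graph n) → IsCotree G → Monotone G
cotree⇒monotone G tr =
  let (xs , forest , all∈) = spanning (complement G) tr
  in vertexStep⇒monotone G (CoforestStep.vertexStep G
       (λ ab bc ac → triangle-free (complement G) (IsTree.acyclic tr) ab bc ac) forest all∈)

-- Unions and joins

module _ {n : ℕ} (G : Graph n) {t : ℕ} {K : DecSet (Fin t)} where

  -- Each vertex of colour `i` in `S` fails to see some other colour and moves to it. Moved vertices
  -- are pairwise non-adjacent, as they shared the colour `i`.
  eliminate : ∀ {S c i} → IsColouring G S K c → ¬ Dominated G S K c i → Colourable G S (K ⊖ i)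
  eliminate {S} {c} {i} col undominated = (λ v → proj₁ (new v)) , record
    { within = λ {v} v∈ → case c v ≟ i of λ where
        (yes c≡i) → let (j∈ , j≢i , _) = moved v v∈ c≡i in j∈ , j≢i
        (no  c≢i) → subst (_∈ K ⊖ i) (sym (kept v c≢i)) (within col v∈ , c≢i)
    ; proper = λ {u} {v} u∈ v∈ e eq → case c u ≟ i of λ where
        (yes cu≡i) → case c v ≟ i of λ where
          (yes cv≡i) → proper col u∈ v∈ e (trans cu≡i (sym cv≡i))
          (no  cv≢i) → proj₂ (proj₂ (moved u u∈ cu≡i)) (v , v∈ , e , trans (sym (kept v cv≢i)) (sym eq))
        (no  cu≢i) → case c v ≟ i of λ where
          (yes cv≡i) → proj₂ (proj₂ (moved v v∈ cv≡i)) (u , u∈ , symm G e , trans (sym (kept u cu≢i)) eq)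
          (no  cv≢i) → proper col u∈ v∈ e (trans (sym (kept u cu≢i)) (trans eq (kept v cv≢i)))
    }
    where
    Missing : Fin n → Fin t → Set
    Missing v j = j ∈ K × j ≢ c v × ¬ Sees G S c v j

    missing? : ∀ v → Dec (∃ (Missing v))
    missing? v = any? λ j → j ∈? K ×-dec ¬? (j ≟ c v) ×-dec ¬? (sees? G S c v j)

    new : ∀ v → ∃ λ j → (c v ≢ i → j ≡ c v) × (v ∈ S → c v ≡ i → j ∈ K × j ≢ i × ¬ Sees G S c v j)
    new v with c v ≟ i | missing? v
    ... | no c≢i | _ = c v , (λ _ → refl) , λ _ c≡i → contradiction c≡i c≢i
    ... | yes refl | yes (j , j∈ , j≢ , ¬sees) = j , (λ c≢ → contradiction refl c≢) , λ _ _ → j∈ , j≢ , ¬sees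
    -- Such a vertex lies outside `S`, for in `S` it would dominate `i`; its colour is arbitrary.
    ... | yes refl | no ¬missing = c v , (λ _ → refl) , λ v∈ _ → ⊥-elim (undominated
      (v , v∈ , refl , λ {j} j∈ j≢ → decidable-stable (sees? G S c v j) λ ¬s → ¬missing (j , j∈ , j≢ , ¬s)))

    kept : ∀ v → c v ≢ i → proj₁ (new v) ≡ c v
    kept v = proj₁ (proj₂ (new v))

    moved : ∀ v → v ∈ S → c v ≡ i → proj₁ (new v) ∈ K × proj₁ (new v) ≢ i × ¬ Sees G S c v (proj₁ (new v))
    moved v = proj₂ (proj₂ (new v))

  fill-colour : ∀ {S c v k} → IsColouring G S K c → k ∈ K → ¬ Used G S c k → IsColouring G S K (c [ v ≔ k ])
  fill-colour {S} {c} {v} {k} col k∈ unused = record { within = c∈ ; proper = pr }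
    where
    c∈ : ∀ {u} → u ∈ S → (c [ v ≔ k ]) u ∈ K
    c∈ {u} u∈ with u ≟ v
    ... | yes refl = subst (_∈ K) (sym (≔-same c)) k∈
    ... | no u≢v = subst (_∈ K) (sym (≔-other c u≢v)) (within col u∈)
    pr : ∀ {u w} → u ∈ S → w ∈ S → Adj G u w → (c [ v ≔ k ]) u ≢ (c [ v ≔ k ]) w
    pr {u} {w} u∈ w∈ e eq with u ≟ v | w ≟ v
    ... | yes refl | yes refl = irrefl G refl e
    ... | yes refl | no w≢v = unused (w , w∈ , trans (sym (≔-other c w≢v)) (trans (sym eq) (≔-same c)))
    ... | no u≢v | yes refl = unused (u , u∈ , trans (sym (≔-other c u≢v)) (trans eq (≔-same c)))
    ... | no u≢v | no w≢v = proper col u∈ w∈ e (trans (sym (≔-other c u≢v)) (trans eq (≔-other c w≢v)))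

  -- As long as a colour k is unused, a vertex that c colours k is recoloured
  -- to k; such a vertex keeps its colour in all later steps.
  surjective-colouring : ∀ {S S′ c} → S ⊆ S′ → Onto G S K c → Colourable G S′ K →
    ∃ λ c′ → IsColouring G S′ K c′ × Onto G S′ K c′
  surjective-colouring {S} {S′} {c} S⊆ onto (c₀ , col₀) =
    go t Sub.⊤ (SubP.∣p∣≤n Sub.⊤) c₀ col₀ λ _ j∉ → contradiction SubP.∈⊤ j∉
    where
    Settled : (Fin n → Fin t) → Fin t → Set
    Settled d j = ∃ λ v → v ∈ S × c v ≡ j × d v ≡ j

    -- Every unsettled colour of `K` lies in `ks`, which loses one element per round; its size
    -- bounds the number of rounds.
    go : ∀ fuel (ks : Sub.Subset t) → Sub.∣ ks ∣ ≤ fuel → ∀ d → IsColouring G S′ K d →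
         (∀ {j} → j ∈ K → j Sub.∉ ks → Settled d j) → ∃ λ c′ → IsColouring G S′ K c′ × Onto G S′ K c′
    go fuel ks size d col settled with unused⊎onto G S′ K d
    ... | inj₂ onto′ = d , col , λ {j} → onto′ {j}
    ... | inj₁ (k , k∈ , unused) = next fuel size
      where
      k∈ks : k Sub.∈ ks
      k∈ks = decidable-stable (k SubP.∈? ks) λ k∉ →
        let (v , v∈ , _ , eq) = settled k∈ k∉ in unused (v , S⊆ v∈ , eq)

      v = proj₁ (onto k∈)
      v∈ = proj₁ (proj₂ (onto k∈))
      cv≡k = proj₂ (proj₂ (onto k∈))

      settled′ : ∀ {j} → j ∈ K → j Sub.∉ ks Sub.- k → Settled (d [ v ≔ k ]) j
      settled′ {j} j∈ j∉ with j ≟ k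
      ... | yes refl = v , v∈ , cv≡k , ≔-same d
      ... | no j≢k = let (w , w∈ , cw , dw) = settled j∈ λ j∈ks → j∉ (SubP.x∈p∧x≢y⇒x∈p-y j∈ks j≢k) in
        w , w∈ , cw , trans (≔-other d λ w≡v → j≢k (trans (sym cw) (trans (cong c w≡v) cv≡k))) dw

      next : ∀ fuel → Sub.∣ ks ∣ ≤ fuel → ∃ λ c′ → IsColouring G S′ K c′ × Onto G S′ K c′
      next zero size = ⊥-elim (n≮0 (≤-trans (SubP.x∈p⇒∣p-x∣<∣p∣ k∈ks) size))
      next (suc fuel) size = go fuel (ks Sub.- k) (s≤s⁻¹ (≤-trans (SubP.x∈p⇒∣p-x∣<∣p∣ k∈ks) size))
        (d [ v ≔ k ]) (fill-colour col k∈ unused) settled′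

-- If the extension misses a colour, it dominates nothing; then neither does `c`, and any colouring
-- onto `K` will do.
monotone-onto : ∀ {n} {G : Graph n} → Monotone G → ∀ {t} (K : DecSet (Fin t)) S S′ → S ⊆ S′ →
  Colourable G S′ K → ∀ c → IsColouring G S K c → Onto G S K c →
  ∃ λ c′ → IsColouring G S′ K c′ × Onto G S′ K c′ × (∀ {j} → Dominated G S K c j → Dominated G S′ K c′ j)
monotone-onto {G = G} mono K S S′ S⊆ colourable c col onto with mono K S S′ S⊆ colourable c col
... | c′ , col′ , dom with unused⊎onto G S′ K c′
... | inj₂ onto′ = c′ , col′ , (λ {j} → onto′ {j}) , λ {j} → dom {j}
... | inj₁ (k , k∈ , unused) =
  let (c″ , col″ , onto″) = surjective-colouring G {K = K} {S} {S′} {c} S⊆ (λ {j} → onto {j}) colourable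
  in c″ , col″ , (λ {j} → onto″ {j}) , λ d → contradiction (dominated⇒onto G S′ {K} {c′} (dom d) k∈) unused

-- Colours outside `A` are dropped one by one as long as the current palette has an undominated
-- colour. This ends at `A` or at a palette that is dominated throughout.
shrink : ∀ {n} (G : Graph n) (S : DecSet (Fin n)) {t} (A A₀ : DecSet (Fin t)) → A ⊆ A₀ → Colourable G S A₀ →
  ∃ λ (A⁺ : DecSet (Fin t)) → A ⊆ A⁺ × A⁺ ⊆ A₀ ×
    (Colourable G S A ⊎ ∃ λ c → IsColouring G S A⁺ c × (∀ {j} → j ∈ A⁺ → Dominated G S A⁺ c j))
shrink G S {t} A A₀ A⊆ (c , col) = go (allFin t) A₀ A⊆ (c , col) λ {j} _ → inj₂ (∈-allFin j)
  where
  go : ∀ js A₀ → A ⊆ A₀ → Colourable G S A₀ → (∀ {j} → j ∈ A₀ → j ∈ A ⊎ j ∈ˡ js) →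
    ∃ λ (A⁺ : DecSet (Fin t)) → A ⊆ A⁺ × A⁺ ⊆ A₀ ×
      (Colourable G S A ⊎ ∃ λ c → IsColouring G S A⁺ c × (∀ {j} → j ∈ A⁺ → Dominated G S A⁺ c j))
  go [] A₀ A⊆ (c , col) cover =
    A₀ , A⊆ , id , inj₁ (c , IsColouring-⊆ G {K = A₀} {A} {S} {S} id ([]-cover A A₀ cover) col)
  go (j ∷ js) A₀ A⊆ (c , col) cover with j ∈? A₀ | j ∈? A
  ... | no j∉A₀ | _       = go js A₀ A⊆ (c , col) (uncons-cover A A₀ cover λ j∈ → contradiction j∈ j∉A₀)
  ... | yes _   | yes j∈A = go js A₀ A⊆ (c , col) (uncons-cover A A₀ cover λ _ → j∈A)
  ... | yes j∈A₀ | no j∉A with any? (λ i → i ∈? A₀ ×-dec ¬? (dominated? G S A₀ c i))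
  ... | no ¬undominated = A₀ , A⊆ , id , inj₂ (c , col , λ {i} i∈ →
    decidable-stable (dominated? G S A₀ c i) λ ¬d → ¬undominated (i , i∈ , ¬d))
  ... | yes (i , i∈ , undominated) =
    let (c′ , col′)           = eliminate G col undominated
        -- The eliminated colour `i` may belong to `A`; renaming makes `j`, which lies outside `A`,
        -- the dropped one.
        (A⁺ , A⊆⁺ , ⁺⊆ , res) = go js (A₀ ⊖ j) (λ k∈ → A⊆ k∈ , λ { refl → j∉A k∈ })
          (transpose i j ∘ c′ , relabel G (transpose i j) (transpose-injective i j)
            (λ {k} → transpose-⊖ A₀ i∈ j∈A₀ {k}) col′)
          (uncons-cover A (A₀ ⊖ j) (λ (k∈ , _) → cover k∈) λ (_ , j≢j) → contradiction refl j≢j)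
    in A⁺ , A⊆⁺ , (λ k∈ → proj₁ (⁺⊆ k∈)) , res

-- Dividing the palette between the two sides of a join.

record Split {t : ℕ} (K A B : DecSet (Fin t)) : Set where
  field
    left     : A ⊆ K
    right    : B ⊆ K
    cover    : ∀ {j} → j ∈ K → j ∈ A ⊎ j ∈ B
    disjoint : ∀ {j} → j ∈ A → ¬ j ∈ B

open Split

Split-sym : ∀ {t} {K A B : DecSet (Fin t)} → Split K A B → Split K B A
Split-sym s = record { left = right s ; right = left s ; cover = swap ∘ cover s ; disjoint = λ b a → disjoint s a b }

exchange-colours : ∀ {n} (G : Graph n) {S : DecSet (Fin n)} {t} (X : DecSet (Fin t)) {i j} → ¬ i ∈ X → j ∈ X →
                   Colourable G S X → Colourable G S (X ⊖ j ⊕ i)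
exchange-colours G {S} X {i} {j} i∉ j∈ (c , col) =
  transpose i j ∘ c , relabel G {K = X} {X ⊖ j ⊕ i} (transpose i j) (transpose-injective i j) moves col
  where
  moves : ∀ {k} → k ∈ X → transpose i j k ∈ X ⊖ j ⊕ i
  moves {k} k∈ = case k ≟ j of λ where
    (yes refl) → inj₂ (transpose-right i k)
    (no k≢j) → inj₁ (subst (_∈ X ⊖ j) (sym (transpose-other (λ { refl → i∉ k∈ }) k≢j)) (k∈ , k≢j))

-- While `A′` lacks some `i` of `A` and has some `j` outside `A`, these two colours change sides by
-- renaming. The resulting comparability by inclusion stands in for a comparison of cardinalities.
balance : ∀ {m n} (G₁ : Graph m) (G₂ : Graph n) {S₁ S₂ t} {K A B : DecSet (Fin t)} → Split K A B →
  ∀ {A′ B′} → Split K A′ B′ → Colourable G₁ S₁ A′ → Colourable G₂ S₂ B′ →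
  ∃ λ A″ → ∃ λ B″ → Split K A″ B″ × Colourable G₁ S₁ A″ × Colourable G₂ S₂ B″ × (A ⊆ A″ ⊎ A″ ⊆ A)
balance G₁ G₂ {S₁} {S₂} {t} {K} {A} {B} s s′ col₁ col₂ =
  go (allFin t) _ _ s′ col₁ col₂ λ {i} _ → inj₂ (∈-allFin i)
  where
  go : ∀ is A′ B′ → Split K A′ B′ → Colourable G₁ S₁ A′ → Colourable G₂ S₂ B′ →
       (∀ {i} → i ∈ A → i ∈ A′ ⊎ i ∈ˡ is) →
       ∃ λ A″ → ∃ λ B″ → Split K A″ B″ × Colourable G₁ S₁ A″ × Colourable G₂ S₂ B″ × (A ⊆ A″ ⊎ A″ ⊆ A)
  go [] A′ B′ s′ col₁ col₂ cov = A′ , B′ , s′ , col₁ , col₂ , inj₁ ([]-cover A′ A cov)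
  go (i ∷ is) A′ B′ s′ col₁ col₂ cov with i ∈? A | i ∈? A′
  ... | no i∉A  | _        = go is A′ B′ s′ col₁ col₂ (uncons-cover A′ A cov λ i∈ → contradiction i∈ i∉A)
  ... | yes _   | yes i∈A′ = go is A′ B′ s′ col₁ col₂ (uncons-cover A′ A cov λ _ → i∈A′)
  ... | yes i∈A | no i∉A′ with any? (λ j → j ∈? A′ ×-dec ¬? (j ∈? A))
  ... | no ¬j = A′ , B′ , s′ , col₁ , col₂ ,
    inj₂ λ {k} k∈ → decidable-stable (k ∈? A) λ k∉ → ¬j (k , k∈ , k∉)
  ... | yes (j , j∈A′ , j∉A) = go is (A′ ⊖ j ⊕ i) (B′ ⊖ i ⊕ j) s″
      (exchange-colours G₁ A′ i∉A′ j∈A′ col₁) (exchange-colours G₂ B′ (disjoint s′ j∈A′) i∈B′ col₂)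
      (uncons-cover (A′ ⊖ j ⊕ i) A cov⁺ λ _ → inj₂ refl)
    where
    i∈B′ : i ∈ B′
    i∈B′ with cover s′ (left s i∈A)
    ... | inj₁ i∈A′ = contradiction i∈A′ i∉A′
    ... | inj₂ i∈B′ = i∈B′
    cov⁺ : ∀ {k} → k ∈ A → k ∈ A′ ⊖ j ⊕ i ⊎ k ∈ˡ i ∷ is
    cov⁺ k∈ with cov k∈
    ... | inj₁ k∈A′ = inj₁ (inj₁ (k∈A′ , λ { refl → j∉A k∈ }))
    ... | inj₂ k∈is = inj₂ k∈is
    s″ : Split K (A′ ⊖ j ⊕ i) (B′ ⊖ i ⊕ j)
    left s″ (inj₁ (k∈ , _)) = left s′ k∈
    left s″ (inj₂ refl) = left s i∈A
    right s″ (inj₁ (k∈ , _)) = right s′ k∈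
    right s″ (inj₂ refl) = left s′ j∈A′
    cover s″ {k} k∈ = case k ≟ i of λ where
      (yes k≡i) → inj₁ (inj₂ k≡i)
      (no k≢i) → case k ≟ j of λ where
        (yes k≡j) → inj₂ (inj₂ k≡j)
        (no k≢j) → case cover s′ k∈ of λ where
          (inj₁ a) → inj₁ (inj₁ (a , k≢j))
          (inj₂ b) → inj₂ (inj₁ (b , k≢i))
    disjoint s″ (inj₁ (a , _)) (inj₁ (b , _)) = disjoint s′ a b
    disjoint s″ (inj₁ (_ , k≢j)) (inj₂ k≡j) = k≢j k≡j
    disjoint s″ (inj₂ k≡i) (inj₁ (_ , k≢i)) = k≢i k≡i
    disjoint s″ (inj₂ refl) (inj₂ refl) = i∉A′ j∈A′

-- One operand of a join with its share of the colouring, bundled so that the operands can exchange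
-- roles.
record Part {t : ℕ} (A : DecSet (Fin t)) : Set₁ where
  field
    {size} : ℕ
    graph  : Graph size
    mono   : Monotone graph
    S S′   : DecSet (Fin size)
    S⊆     : S ⊆ S′
    c      : Fin size → Fin t
    col    : IsColouring graph S A c
    onto   : Onto graph S A c

  Col : DecSet (Fin t) → Set
  Col = Colourable graph S′

  Dom : Fin t → Set
  Dom = Dominated graph S A c

  Dom′ : DecSet (Fin t) → (Fin size → Fin t) → Fin t → Set
  Dom′ = Dominated graph S′

  OntoColouring : DecSet (Fin t) → Set
  OntoColouring A′ = ∃ λ c′ → IsColouring graph S′ A′ c′ × Onto graph S′ A′ c′

module _ {t : ℕ} {K : DecSet (Fin t)} where

  open Part

  -- In a join a vertex sees every colour used on the other side, so domination can be tested within
  -- one side once both colourings are onto. A dominated colour may change sides.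
  Result : ∀ {A B : DecSet (Fin t)} → Part A → Part B → Set₁
  Result P Q = ∃ λ A′ → ∃ λ B′ → Split K A′ B′ ×
    ∃ λ (c₁ : OntoColouring P A′) → ∃ λ (c₂ : OntoColouring Q B′) →
    ∀ {j} → Dom P j ⊎ Dom Q j → Dom′ P A′ (proj₁ c₁) j ⊎ Dom′ Q B′ (proj₁ c₂) j

  Result-sym : ∀ {A B} {P : Part A} {Q : Part B} → Result P Q → Result Q P
  Result-sym (A′ , B′ , s , c₁ , c₂ , dom) = B′ , A′ , Split-sym s , c₂ , c₁ , swap ∘ dom ∘ swap

  -- If A cannot be used on P.S′, take a least superset A⁺ of A that can: then
  -- all its colours are dominated, and Q gives up the vertices coloured by A⁺.
  enlarge : ∀ {A B A₀ B₀} (P : Part A) (Q : Part B) → Split K A B → Split K A₀ B₀ → A ⊆ A₀ →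
            Col P A₀ → Col Q B₀ → Result P Q
  enlarge {A} {B} {A₀} {B₀} P Q s s₀ A⊆A₀ col₁ (c₂ , col₂) with shrink (graph P) (S′ P) A A₀ A⊆A₀ col₁
  ... | A⁺ , A⊆A⁺ , A⁺⊆A₀ , inj₁ colourable =
    let (c₁′ , col₁′ , onto₁′ , dom₁) = monotone-onto (mono P) A (S P) (S′ P) (S⊆ P)
          colourable (c P) (col P) (λ {j} → onto P {j})
        (c₂′ , col₂′ , onto₂′ , dom₂) = monotone-onto (mono Q) B (S Q) (S′ Q) (S⊆ Q)
          (c₂ , IsColouring-⊆ (graph Q) {K = B₀} {B} {S′ Q} {S′ Q} id B₀⊆B col₂) (c Q) (col Q) (λ {j} → onto Q {j})
    in A , B , s , (c₁′ , col₁′ , λ {j} → onto₁′ {j}) , (c₂′ , col₂′ , λ {j} → onto₂′ {j}) ,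
       λ { (inj₁ d) → inj₁ (dom₁ d) ; (inj₂ d) → inj₂ (dom₂ d) }
    where
    B₀⊆B : B₀ ⊆ B
    B₀⊆B j∈ with cover s (right s₀ j∈)
    ... | inj₁ j∈A = contradiction j∈ (disjoint s₀ (A⊆A₀ j∈A))
    ... | inj₂ j∈B = j∈B
  ... | A⁺ , A⊆A⁺ , A⁺⊆A₀ , inj₂ (c₁′ , col₁′ , dom₁) =
    let (c₂′ , col₂′ , onto₂′ , dom₂) = monotone-onto (mono Q) B⁻ T (S′ Q) (λ (v∈ , _) → S⊆ Q v∈)
          (c₂ , IsColouring-⊆ (graph Q) {K = B₀} {B⁻} {S′ Q} {S′ Q} id B₀⊆B⁻ col₂) (c Q) colT (λ {j} → ontoT {j})
    in A⁺ , B⁻ , s⁺ ,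
       (c₁′ , col₁′ , λ j∈ → let (v , v∈ , eq , _) = dom₁ j∈ in v , v∈ , eq) ,
       (c₂′ , col₂′ , λ {j} → onto₂′ {j}) ,
       -- The colours of `P` lie in `A⁺`, all of which is now dominated.
       λ { (inj₁ (v , v∈ , refl , _)) → inj₁ (dom₁ (A⊆A⁺ (within (col P) v∈)))
         ; {j} (inj₂ d) → case j ∈? A⁺ of λ where
             (yes j∈A⁺) → inj₁ (dom₁ j∈A⁺)
             (no j∉A⁺)  → inj₂ (dom₂ (domT d j∉A⁺)) }
    where
    B⁻ : DecSet (Fin t)
    B⁻ = K ∖ A⁺

    B⁻⊆B : B⁻ ⊆ B
    B⁻⊆B (j∈ , j∉) with cover s j∈
    ... | inj₁ j∈A = contradiction (A⊆A⁺ j∈A) j∉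
    ... | inj₂ j∈B = j∈B

    B₀⊆B⁻ : B₀ ⊆ B⁻
    B₀⊆B⁻ j∈ = right s₀ j∈ , λ j∈A⁺ → disjoint s₀ (A⁺⊆A₀ j∈A⁺) j∈

    T : DecSet (Fin (size Q))
    T = S Q ∩ preimage (c Q) B⁻

    colT : IsColouring (graph Q) T B⁻ (c Q)
    within colT (_ , cv∈) = cv∈
    proper colT (u∈ , _) (v∈ , _) = proper (col Q) u∈ v∈

    ontoT : Onto (graph Q) T B⁻ (c Q)
    ontoT j∈ = let (v , v∈ , eq) = onto Q (B⁻⊆B j∈) in v , (v∈ , subst (_∈ B⁻) (sym eq) j∈) , eq

    -- Neighbours with colours in `B⁻` survive in `T`, so a dominating vertex that is kept still
    -- sees all it needs.
    domT : ∀ {j} → Dom Q j → ¬ j ∈ A⁺ → Dominated (graph Q) T B⁻ (c Q) j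
    domT (v , v∈ , refl , dom) j∉ = v , (v∈ , right s (within (col Q) v∈) , j∉) , refl , λ k∈ k≢ →
      let (w , w∈ , e , eq) = dom (B⁻⊆B k∈) k≢ in w , (w∈ , subst (_∈ B⁻) (sym eq) k∈) , e , eq

    s⁺ : Split K A⁺ B⁻
    left s⁺ j∈ = left s₀ (A⁺⊆A₀ j∈)
    right s⁺ = proj₁
    cover s⁺ {j} j∈ = case j ∈? A⁺ of λ where
      (yes a) → inj₁ a
      (no ¬a) → inj₂ (j∈ , ¬a)
    disjoint s⁺ a (_ , ¬a) = ¬a a

  -- After balancing, the new palette of one side contains its old one, by complementation in `K`;
  -- that side is the one to enlarge.
  rebalance : ∀ {A B A₀ B₀} (P : Part A) (Q : Part B) → Split K A B → Split K A₀ B₀ →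
              Col P A₀ → Col Q B₀ → Result P Q
  rebalance {A} {B} P Q s s₀ col₁ col₂ with balance (graph P) (graph Q) {S′ P} {S′ Q} s s₀ col₁ col₂
  ... | A₁ , B₁ , s₁ , col₁′ , col₂′ , inj₁ A⊆A₁ = enlarge P Q s s₁ A⊆A₁ col₁′ col₂′
  ... | A₁ , B₁ , s₁ , col₁′ , col₂′ , inj₂ A₁⊆A =
    Result-sym {P = Q} {P} (enlarge Q P (Split-sym s) (Split-sym s₁) B⊆B₁ col₂′ col₁′)
    where
    B⊆B₁ : B ⊆ B₁
    B⊆B₁ j∈ with cover s₁ (right s j∈)
    ... | inj₁ j∈A₁ = contradiction j∈ (disjoint s (A₁⊆A j∈A₁))
    ... | inj₂ j∈B₁ = j∈B₁

-- Graphs assembled from two sides.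

record Embedding {m n : ℕ} (H : Graph m) (G : Graph n) : Set where
  field
    at       : Fin m → Fin n
    preserve : ∀ {a b} → Adj H a b → Adj G (at a) (at b)
    reflect  : ∀ {a b} → Adj G (at a) (at b) → Adj H a b

open Embedding

module _ {m n : ℕ} {H : Graph m} {G : Graph n} (e : Embedding H G) (S : DecSet (Fin n)) {t : ℕ} where

  pull-colouring : ∀ {K : DecSet (Fin t)} {c} → IsColouring G S K c →
                   IsColouring H (preimage (at e) S) K (c ∘ at e)
  within (pull-colouring col) = within col
  proper (pull-colouring col) u∈ v∈ uv = proper col u∈ v∈ (preserve e uv)

  push-sees : ∀ {c : Fin n → Fin t} {d} → (∀ a → c (at e a) ≡ d a) → ∀ {a j} →
              Sees H (preimage (at e) S) d a j → Sees G S c (at e a) j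
  push-sees c≗d (w , w∈ , aw , eq) = at e w , w∈ , preserve e aw , trans (c≗d w) eq

-- The field `glue` encodes that both embeddings are injective with disjoint images, in the form in
-- which colourings are combined.
record Parted {n m k : ℕ} (G : Graph n) (G₁ : Graph m) (G₂ : Graph k) : Set₁ where
  field
    e₁    : Embedding G₁ G
    e₂    : Embedding G₂ G
    view  : ∀ v → (∃ λ a → at e₁ a ≡ v) ⊎ (∃ λ b → at e₂ b ≡ v)
    glue  : {A : Set} (c₁ : Fin m → A) (c₂ : Fin k → A) →
            ∃ λ (c : Fin n → A) → (∀ a → c (at e₁ a) ≡ c₁ a) × (∀ b → c (at e₂ b) ≡ c₂ b)

module _ {n m k : ℕ} {G : Graph n} {G₁ : Graph m} {G₂ : Graph k} (parted : Parted G G₁ G₂)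
         (mono₁ : Monotone G₁) (mono₂ : Monotone G₂) where

  open Parted parted

  i₁ = at e₁
  i₂ = at e₂

  -- Both sides share the palette `K`. A vertex has neighbours on its own side only, so domination
  -- in `G` is domination within a side.
  disjoint-monotone : (∀ {a b} → ¬ Adj G (i₁ a) (i₂ b)) → Monotone G
  disjoint-monotone apart K S S′ S⊆ (c₀ , col₀) c col = c′ , col′ , dominated
    where
    part₁ = mono₁ K (preimage i₁ S) (preimage i₁ S′) S⊆ (c₀ ∘ i₁ , pull-colouring e₁ S′ col₀)
                  (c ∘ i₁) (pull-colouring e₁ S col)
    part₂ = mono₂ K (preimage i₂ S) (preimage i₂ S′) S⊆ (c₀ ∘ i₂ , pull-colouring e₂ S′ col₀)
                  (c ∘ i₂) (pull-colouring e₂ S col)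

    c₁ = proj₁ part₁
    col₁ = proj₁ (proj₂ part₁)
    c₂ = proj₁ part₂
    col₂ = proj₁ (proj₂ part₂)

    c′ = proj₁ (glue c₁ c₂)
    c′₁ = proj₁ (proj₂ (glue c₁ c₂))
    c′₂ = proj₂ (proj₂ (glue c₁ c₂))

    col′ : IsColouring G S′ K c′
    within col′ {v} v∈ with view v
    ... | inj₁ (a , refl) = subst (_∈ K) (sym (c′₁ a)) (within col₁ v∈)
    ... | inj₂ (b , refl) = subst (_∈ K) (sym (c′₂ b)) (within col₂ v∈)
    proper col′ {u} {v} u∈ v∈ uv eq with view u | view v
    ... | inj₁ (a , refl) | inj₁ (b , refl) =
      proper col₁ u∈ v∈ (reflect e₁ uv) (trans (sym (c′₁ a)) (trans eq (c′₁ b)))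
    ... | inj₁ (a , refl) | inj₂ (b , refl) = apart uv
    ... | inj₂ (a , refl) | inj₁ (b , refl) = apart (symm G uv)
    ... | inj₂ (a , refl) | inj₂ (b , refl) =
      proper col₂ u∈ v∈ (reflect e₂ uv) (trans (sym (c′₂ a)) (trans eq (c′₂ b)))

    dominated : ∀ {j} → Dominated G S K c j → Dominated G S′ K c′ j
    dominated (v , v∈ , eq , dom) with view v
    ... | inj₁ (a , refl) =
      let (x , x∈ , eq′ , dom′) = proj₂ (proj₂ part₁) (a , v∈ , eq , dom₁)
      in i₁ x , x∈ , trans (c′₁ x) eq′ , λ j∈ j≢ →
           push-sees e₁ S′ c′₁ (dom′ j∈ λ j≡ → j≢ (trans j≡ (sym (c′₁ x))))
      where
      dom₁ : DominatingIn G₁ (preimage i₁ S) K (c ∘ i₁) a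
      dom₁ j∈ j≢ with dom j∈ j≢
      ... | w , w∈ , vw , cw with view w
      ... | inj₁ (b , refl) = b , w∈ , reflect e₁ vw , cw
      ... | inj₂ (b , refl) = ⊥-elim (apart vw)
    ... | inj₂ (a , refl) =
      let (x , x∈ , eq′ , dom′) = proj₂ (proj₂ part₂) (a , v∈ , eq , dom₂)
      in i₂ x , x∈ , trans (c′₂ x) eq′ , λ j∈ j≢ →
           push-sees e₂ S′ c′₂ (dom′ j∈ λ j≡ → j≢ (trans j≡ (sym (c′₂ x))))
      where
      dom₂ : DominatingIn G₂ (preimage i₂ S) K (c ∘ i₂) a
      dom₂ j∈ j≢ with dom j∈ j≢
      ... | w , w∈ , vw , cw with view w
      ... | inj₁ (b , refl) = ⊥-elim (apart (symm G vw))
      ... | inj₂ (b , refl) = b , w∈ , reflect e₂ vw , cw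

  module Complete (across : ∀ {a b} → Adj G (i₁ a) (i₂ b))
    {t : ℕ} (K : DecSet (Fin t)) {S S′ : DecSet (Fin n)} (S⊆ : S ⊆ S′) where

    -- The second palette is all that the first side leaves over, which makes the split automatic;
    -- the edges across keep the second side within it.
    usedBy₁ usedBy₂ : DecSet (Fin n) → (Fin n → Fin t) → DecSet (Fin t)
    usedBy₁ T c = K ∩ record { El = Used G₁ (preimage i₁ T) (c ∘ i₁) ; el? = used? G₁ (preimage i₁ T) (c ∘ i₁) }
    usedBy₂ T c = K ∖ usedBy₁ T c

    module _ {T : DecSet (Fin n)} {c : Fin n → Fin t} (col : IsColouring G T K c) where

      split : Split K (usedBy₁ T c) (usedBy₂ T c)
      split = record
        { left     = proj₁
        ; right    = proj₁
        ; cover    = λ {j} j∈ → case j ∈? usedBy₁ T c of λ where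
            (yes u) → inj₁ u
            (no ¬u) → inj₂ (j∈ , ¬u)
        ; disjoint = λ u (_ , ¬u) → ¬u u }

      colouring₁ : IsColouring G₁ (preimage i₁ T) (usedBy₁ T c) (c ∘ i₁)
      within colouring₁ a∈ = within col a∈ , _ , a∈ , refl
      proper colouring₁ = proper (pull-colouring e₁ T col)

      colouring₂ : IsColouring G₂ (preimage i₂ T) (usedBy₂ T c) (c ∘ i₂)
      within colouring₂ b∈ = within col b∈ , λ (_ , a , a∈ , eq) → proper col a∈ b∈ across eq
      proper colouring₂ = proper (pull-colouring e₂ T col)

      onto₁ : Onto G₁ (preimage i₁ T) (usedBy₁ T c) (c ∘ i₁)
      onto₁ (_ , u) = u

      onto₂ : Onto G T K c → Onto G₂ (preimage i₂ T) (usedBy₂ T c) (c ∘ i₂)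
      onto₂ onto (j∈ , ¬u) with onto j∈
      ... | v , v∈ , eq with view v
      ... | inj₁ (a , refl) = contradiction (j∈ , a , v∈ , eq) ¬u
      ... | inj₂ (b , refl) = b , v∈ , eq

    module _ {c₀ : Fin n → Fin t} (col₀ : IsColouring G S′ K c₀) {c : Fin n → Fin t}
             (col : IsColouring G S K c) (onto : Onto G S K c) where

      P : Part (usedBy₁ S c)
      P = record { graph = G₁ ; mono = mono₁ ; S = preimage i₁ S ; S′ = preimage i₁ S′ ; S⊆ = S⊆
                 ; c = c ∘ i₁ ; col = colouring₁ col ; onto = λ {j} → onto₁ col {j} }

      Q : Part (usedBy₂ S c)
      Q = record { graph = G₂ ; mono = mono₂ ; S = preimage i₂ S ; S′ = preimage i₂ S′ ; S⊆ = S⊆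
                 ; c = c ∘ i₂ ; col = colouring₂ col ; onto = λ {j} → onto₂ col (λ {j} → onto {j}) {j} }

      extends : Extends G K S S′ c
      extends with rebalance {K = K} P Q (split col) (split col₀) (c₀ ∘ i₁ , colouring₁ col₀) (c₀ ∘ i₂ , colouring₂ col₀)
      ... | A , B , s , (c₁ , col₁ , on₁) , (c₂ , col₂ , on₂) , dom = c′ , col′ , dominated
        where
        c′ = proj₁ (glue c₁ c₂)
        c′₁ = proj₁ (proj₂ (glue c₁ c₂))
        c′₂ = proj₂ (proj₂ (glue c₁ c₂))

        differ : ∀ {a b} → i₁ a ∈ S′ → i₂ b ∈ S′ → c′ (i₁ a) ≢ c′ (i₂ b)
        differ {a} {b} a∈ b∈ eq = Split.disjoint s (within col₁ a∈)
          (subst (_∈ B) (trans (sym (c′₂ b)) (trans (sym eq) (c′₁ a))) (within col₂ b∈))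

        col′ : IsColouring G S′ K c′
        within col′ {v} v∈ with view v
        ... | inj₁ (a , refl) = subst (_∈ K) (sym (c′₁ a)) (Split.left s (within col₁ v∈))
        ... | inj₂ (b , refl) = subst (_∈ K) (sym (c′₂ b)) (Split.right s (within col₂ v∈))
        proper col′ {u} {v} u∈ v∈ uv eq with view u | view v
        ... | inj₁ (a , refl) | inj₁ (b , refl) =
          proper col₁ u∈ v∈ (reflect e₁ uv) (trans (sym (c′₁ a)) (trans eq (c′₁ b)))
        ... | inj₁ (a , refl) | inj₂ (b , refl) = differ u∈ v∈ eq
        ... | inj₂ (a , refl) | inj₁ (b , refl) = differ v∈ u∈ (sym eq)
        ... | inj₂ (a , refl) | inj₂ (b , refl) =
          proper col₂ u∈ v∈ (reflect e₂ uv) (trans (sym (c′₂ a)) (trans eq (c′₂ b)))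

        -- Colours of the opposite palette are seen along edges across, because the opposite
        -- colouring uses all of them.
        push : ∀ {j} → Part.Dom′ P A c₁ j ⊎ Part.Dom′ Q B c₂ j → Dominated G S′ K c′ j
        push (inj₁ (x , x∈ , eq , d)) = i₁ x , x∈ , trans (c′₁ x) eq , λ j∈ j≢ →
          case Split.cover s j∈ of λ where
            (inj₁ j∈A) → push-sees e₁ S′ c′₁ (d j∈A λ j≡ → j≢ (trans j≡ (sym (c′₁ x))))
            (inj₂ j∈B) → let (b , b∈ , cb) = on₂ j∈B in i₂ b , b∈ , across , trans (c′₂ b) cb
        push (inj₂ (x , x∈ , eq , d)) = i₂ x , x∈ , trans (c′₂ x) eq , λ j∈ j≢ →
          case Split.cover s j∈ of λ where
            (inj₁ j∈A) → let (a , a∈ , ca) = on₁ j∈A in i₁ a , a∈ , symm G across , trans (c′₁ a) ca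
            (inj₂ j∈B) → push-sees e₂ S′ c′₂ (d j∈B λ j≡ → j≢ (trans j≡ (sym (c′₂ x))))

        dominated : ∀ {j} → Dominated G S K c j → Dominated G S′ K c′ j
        dominated (v , v∈ , eq , d) with view v
        ... | inj₁ (a , refl) = push (dom (inj₁ (a , v∈ , eq , d₁)))
          where
          d₁ : DominatingIn G₁ (preimage i₁ S) (usedBy₁ S c) (c ∘ i₁) a
          d₁ (j∈ , u∈) j≢ with d j∈ j≢
          ... | w , w∈ , vw , cw with view w
          ... | inj₁ (b , refl) = b , w∈ , reflect e₁ vw , cw
          ... | inj₂ (b , refl) = let (a′ , a′∈ , eq′) = u∈ in
            ⊥-elim (proper col a′∈ w∈ across (trans eq′ (sym cw)))
        ... | inj₂ (b , refl) = push (dom (inj₂ (b , v∈ , eq , d₂)))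
          where
          d₂ : DominatingIn G₂ (preimage i₂ S) (usedBy₂ S c) (c ∘ i₂) b
          d₂ (j∈ , ¬u) j≢ with d j∈ j≢
          ... | w , w∈ , vw , cw with view w
          ... | inj₁ (a , refl) = contradiction (j∈ , a , w∈ , cw) ¬u
          ... | inj₂ (b′ , refl) = b′ , w∈ , reflect e₂ vw , cw

  complete-monotone : (∀ {a b} → Adj G (i₁ a) (i₂ b)) → Monotone G
  complete-monotone across K S S′ S⊆ (c₀ , col₀) c col with unused⊎onto G S K c
  ... | inj₁ (j , j∈ , unused) = c₀ , col₀ , λ d → contradiction (dominated⇒onto G S {K} d j∈) unused
  ... | inj₂ onto = Complete.extends across K S⊆ col₀ col (λ {j} → onto {j})

module _ {n m k : ℕ} {G : Graph n} {G₁ : Graph m} {G₂ : Graph k} where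

  module Placed {H : Graph (m + k)} (iso : G ≅ H)
    (H₁ : ∀ {a b} → Adj H (a ↑ˡ k) (b ↑ˡ k) ⇔ Adj G₁ a b)
    (H₂ : ∀ {a b} → Adj H (m ↑ʳ a) (m ↑ʳ b) ⇔ Adj G₂ a b) where

    open _≅_ iso
    open Inverse vertices using (to; from; strictlyInverseˡ; strictlyInverseʳ)

    place : Fin (m + k) → Fin n
    place = from

    edge : ∀ {x y} → Adj G (place x) (place y) ⇔ Adj H x y
    edge {x} {y} = mk⇔
      (λ e → subst₂ (Adj H) (strictlyInverseˡ x) (strictlyInverseˡ y) (Equivalence.to (edges _ _) e))
      (λ e → Equivalence.from (edges _ _)
        (subst₂ (Adj H) (sym (strictlyInverseˡ x)) (sym (strictlyInverseˡ y)) e))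

    parted : Parted G G₁ G₂
    parted = record
      { e₁ = record { at = λ a → place (a ↑ˡ k)
                    ; preserve = λ e → Equivalence.from edge (Equivalence.from H₁ e)
                    ; reflect = λ e → Equivalence.to H₁ (Equivalence.to edge e) }
      ; e₂ = record { at = λ b → place (m ↑ʳ b)
                    ; preserve = λ e → Equivalence.from edge (Equivalence.from H₂ e)
                    ; reflect = λ e → Equivalence.to H₂ (Equivalence.to edge e) }
      ; view = view
      ; glue = λ c₁ c₂ → [ c₁ , c₂ ]′ ∘ splitAt m ∘ to ,
          (λ a → cong [ c₁ , c₂ ]′ (trans (cong (splitAt m) (strictlyInverseˡ _)) (splitAt-↑ˡ m a k))) ,
          (λ b → cong [ c₁ , c₂ ]′ (trans (cong (splitAt m) (strictlyInverseˡ _)) (splitAt-↑ʳ m k b)))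
      }
      where
      view : ∀ v → (∃ λ a → place (a ↑ˡ k) ≡ v) ⊎ (∃ λ b → place (m ↑ʳ b) ≡ v)
      view v with splitAt m (to v) | join-splitAt m k (to v)
      ... | inj₁ a | eq = inj₁ (a , trans (cong from eq) (strictlyInverseʳ v))
      ... | inj₂ b | eq = inj₂ (b , trans (cong from eq) (strictlyInverseʳ v))

  union₁ : ∀ {a b} → Adj (G₁ ∪ G₂) (a ↑ˡ k) (b ↑ˡ k) ⇔ Adj G₁ a b
  union₁ {a} {b} rewrite splitAt-↑ˡ m a k | splitAt-↑ˡ m b k = mk⇔ (λ { (PW.inj₁ e) → e }) PW.inj₁

  union₂ : ∀ {a b} → Adj (G₁ ∪ G₂) (m ↑ʳ a) (m ↑ʳ b) ⇔ Adj G₂ a b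
  union₂ {a} {b} rewrite splitAt-↑ʳ m k a | splitAt-↑ʳ m k b = mk⇔ (λ { (PW.inj₂ e) → e }) PW.inj₂

  union-apart : ∀ {a b} → ¬ Adj (G₁ ∪ G₂) (a ↑ˡ k) (m ↑ʳ b)
  union-apart {a} {b} rewrite splitAt-↑ˡ m a k | splitAt-↑ʳ m k b = λ ()

  join₁ : ∀ {a b} → Adj (G₁ ∨ G₂) (a ↑ˡ k) (b ↑ˡ k) ⇔ Adj G₁ a b
  join₁ {a} {b} rewrite splitAt-↑ˡ m a k | splitAt-↑ˡ m b k =
    mk⇔ (λ { (inj₁ (PW.inj₁ e)) → e ; (inj₂ ()) }) (λ e → inj₁ (PW.inj₁ e))

  join₂ : ∀ {a b} → Adj (G₁ ∨ G₂) (m ↑ʳ a) (m ↑ʳ b) ⇔ Adj G₂ a b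
  join₂ {a} {b} rewrite splitAt-↑ʳ m k a | splitAt-↑ʳ m k b =
    mk⇔ (λ { (inj₁ (PW.inj₂ e)) → e ; (inj₂ ()) }) (λ e → inj₁ (PW.inj₂ e))

  join-across : ∀ {a b} → Adj (G₁ ∨ G₂) (a ↑ˡ k) (m ↑ʳ b)
  join-across {a} {b} rewrite splitAt-↑ˡ m a k | splitAt-↑ʳ m k b = inj₂ left-right

  union-monotone : Monotone G₁ → Monotone G₂ → G ≅ (G₁ ∪ G₂) → Monotone G
  union-monotone mono₁ mono₂ iso = disjoint-monotone parted mono₁ mono₂ λ e → union-apart (Equivalence.to edge e)
    where open Placed iso (λ {a} {b} → union₁ {a} {b}) (λ {a} {b} → union₂ {a} {b})

  join-monotone : Monotone G₁ → Monotone G₂ → G ≅ (G₁ ∨ G₂) → Monotone G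
  join-monotone mono₁ mono₂ iso = complete-monotone parted mono₁ mono₂
    λ {a} {b} → Equivalence.from edge (join-across {a} {b})
    where open Placed iso (λ {a} {b} → join₁ {a} {b}) (λ {a} {b} → join₂ {a} {b})

treeCograph⇒monotone : {n : ℕ} {G : Graph n} → TreeCograph G → Monotone G
treeCograph⇒monotone {G = G} (tree tr)    = tree⇒monotone G tr
treeCograph⇒monotone {G = G} (cotree tr)  = cotree⇒monotone G tr
treeCograph⇒monotone (union G₁ G₂ iso) =
  union-monotone (treeCograph⇒monotone G₁) (treeCograph⇒monotone G₂) iso
treeCograph⇒monotone (join G₁ G₂ iso) =
  join-monotone (treeCograph⇒monotone G₁) (treeCograph⇒monotone G₂) iso

-- Between b-colorings of induced subgraphs and colourings of vertex sets.

range : {m n : ℕ} → (Fin m → Fin n) → DecSet (Fin n)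
range f = record { El = λ y → ∃ λ x → f x ≡ y ; el? = λ y → any? λ x → f x ≟ y }

extend : {m n : ℕ} {A : Set} {f : Fin m → Fin n} → Injective _≡_ _≡_ f → A → (c : Fin m → A) →
         ∃ λ (ĉ : Fin n → A) → ∀ x → ĉ (f x) ≡ c x
extend {m} {n} {A} {f} inj d c = ĉ , ĉ-f
  where
  ĉ : Fin n → A
  ĉ y with any? (λ x → f x ≟ y)
  ... | yes (x , _) = c x
  ... | no  _       = d
  ĉ-f : ∀ x → ĉ (f x) ≡ c x
  ĉ-f x with any? (λ x′ → f x′ ≟ f x)
  ... | yes (x′ , eq) = cong c (inj eq)
  ... | no  ¬x        = contradiction (x , refl) ¬x

module _ {m n : ℕ} {H : Graph m} {G : Graph n} (e : Embedding H G) {t : ℕ} where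

  range-colouring : ∀ {c : Fin m → Fin t} {ĉ} → (∀ x → ĉ (at e x) ≡ c x) → Proper H c →
                    IsColouring G (range (at e)) full ĉ
  within (range-colouring ĉ≗c pr) _ = tt
  proper (range-colouring ĉ≗c pr) (x , refl) (y , refl) xy eq =
    pr x y (reflect e xy) (trans (sym (ĉ≗c x)) (trans eq (ĉ≗c y)))

  bColoring⇒dominated : ∀ {c : Fin m → Fin t} {ĉ} → (∀ x → ĉ (at e x) ≡ c x) → IsBColoring H c →
                        ∀ j → Dominated G (range (at e)) full ĉ j
  bColoring⇒dominated ĉ≗c (_ , rep) j = let (v , eq , dom) = rep j in
    at e v , (v , refl) , trans (ĉ≗c v) eq , λ {k} _ k≢ →
      let (w , vw , cw) = dom k (λ k≡ → k≢ (trans k≡ (sym (ĉ≗c v))))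
      in at e w , (w , refl) , preserve e vw , trans (ĉ≗c w) cw

  dominated⇒bColoring : ∀ {ĉ : Fin n → Fin t} → IsColouring G (range (at e)) full ĉ →
                        (∀ j → Dominated G (range (at e)) full ĉ j) → IsBColoring H (ĉ ∘ at e)
  dominated⇒bColoring {ĉ} col dominated =
    (λ u v uv → proper col (u , refl) (v , refl) (preserve e uv)) , rep
    where
    rep : ∀ j → ∃ λ v → ĉ (at e v) ≡ j × Dominating H (ĉ ∘ at e) v
    rep j with dominated j
    ... | _ , (v , refl) , eq , dom = v , eq , λ k k≢ → sees (dom {k} tt k≢)
      where
      sees : ∀ {k} → Sees G (range (at e)) ĉ (at e v) k → ∃ λ w → Adj H v w × ĉ (at e w) ≡ k
      sees (_ , (w , refl) , vw , cw) = w , reflect e vw , cw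

induced : {n : ℕ} (G : Graph n) (S : Sub.Subset n) → Embedding (G [ S ]) G
induced G S = record { at = element S ; preserve = id ; reflect = id }

theorem24 : ∀ {n : ℕ} (G : Graph n) → TreeCograph G → BMonotonic G
theorem24 {n} G tc S₁ S₂ = ≮⇒≥ λ s<t → <⇒≱ s<t (raise s<t)
  where
  H₁ = G [ S₁ ]
  H₂ = H₁ [ S₂ ]

  e₁ : Embedding H₁ G
  e₁ = induced G S₁

  e₂ : Embedding H₂ G
  e₂ = record { at = element S₁ ∘ element S₂ ; preserve = id ; reflect = id }

  -- An optimal coloring of `H₁` shows that `H₁` is colourable by the larger palette of `H₂`.
  -- Monotonicity then turns an optimal b-coloring of `H₂` into a b-coloring of `H₁` with as many
  -- colours.
  raise : χb H₁ < χb H₂ → χb H₂ ≤ χb H₁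
  raise s<t =
    let (c₁ , pr₁ , _) = proj₁ (χb-isMaximum H₁)
        (c₂ , b₂)      = proj₁ (χb-isMaximum H₂)
        -- The inequality `s<t` both includes the colours of `H₁` in the larger palette and supplies
        -- a default colour for the remaining vertices of `G`.
        (ĉ₁ , ĉ₁≗)     = extend (element-injective S₁) (fromℕ< s<t) (λ v → inject≤ (c₁ v) (<⇒≤ s<t))
        (ĉ₂ , ĉ₂≗)     = extend (λ eq → element-injective S₂ (element-injective S₁ eq)) (fromℕ< s<t) c₂
        (c′ , col′ , dom) = treeCograph⇒monotone tc full (range (at e₂)) (range (at e₁))
          (λ { (x , refl) → element S₂ x , refl })
          (ĉ₁ , range-colouring e₁ ĉ₁≗ λ u v uv eq → pr₁ u v uv (inject≤-injective _ _ _ _ eq))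
          ĉ₂ (range-colouring e₂ ĉ₂≗ (proj₁ b₂))
    in proj₂ (χb-isMaximum H₁) _
         (c′ ∘ at e₁ , dominated⇒bColoring e₁ col′ λ j → dom (bColoring⇒dominated e₂ ĉ₂≗ b₂ j))
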